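{- Let $p,q,m$ be non-negative integers and let $G_{q+m}$ and $H_{p+m}$ be two abelian groups of orders $q+m$ and $p+m$, respectively. Let $\mathcal R$ (resp. $\tilde{\mathcal R}$) be the regular representation of $G_{q+m}$ (resp. $H_{p+m}$) over $\mathbb C$. If $\gcd(p,q,m)=1$, then $$\dim\big(\mathcal S^p(\mathcal R)\otimes\wedge^m(\mathcal R)\big)_{G_{q+m}}=\dim\big(\mathcal S^q(\tilde{\mathcal R})\otimes\wedge^m(\tilde{\mathcal R})\big)_{H_{p+m}}.$$ Indeed, both dimensions are equal to $\frac{1}{p+q+m}\binom{p+q+m}{p,q,m}$.
   Context: For a finite group $G$ and a finite-dimensional representation $V$ of $G$ over $\mathbb C$, $\mathcal S^p(V)$ is the $p$-th symmetric power of $V$ and $\wedge^m(V)$ the $m$-th exterior power, each with the induced action of $G$, and $\mathcal S^p(V)\otimes\wedge^m(V)$ carries the diagonal $G$-action. The notation $\big(\mathcal S^p(V)\otimes\wedge^m(V)\big)_{G}$ denotes the isotypic component of $\mathcal S^p(V)\otimes\wedge^m(V)$ corresponding to the trivial representation of $G$ (i.e. the subspace of $G$-invariants). The orders $q+m$ and $p+m$ are positive, being orders of groups. The multinomial coefficient is $\binom{p+q+m}{p,q,m}=\frac{(p+q+m)!}{p!\,q!\,m!}$. -}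

module Defs where

open import Level using (Level; _⊔_; 0ℓ) renaming (suc to lsuc)
open import Algebra.Bundles using (CommutativeRing; Group; AbelianGroup)
open import Algebra.Module.Bundles using (Module)
open import Algebra.Module.Morphism.Structures using (IsModuleHomomorphism)
open import Algebra.Module.Structures.Biased using (IsModuleFromLeft)
import Algebra.Properties.Monoid.Sum as Sum
open import Data.Fin.Base using (Fin)
open import Data.Fin.Permutation using (Permutation′; _⟨$⟩ʳ_)
open import Data.Nat.Base as ℕ using (ℕ; NonZero)
import Data.Nat.Properties as ℕ
open import Data.Nat.DivMod using (_/_)
open import Data.Product using (Σ; ∃; _×_; _,_; proj₁; proj₂)
import Data.Rational.Base as ℚ
open ℚ using (ℚ; 0ℚ; 1ℚ; ½)
import Data.Rational.Properties as ℚ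
import Data.Rational.Solver as ℚ
open import Data.Vec.Functional using (Vector)
open import Function.Base using (_∘_; flip)
open import Function.Bundles using (Inverse)
open import Relation.Binary.Core using (Rel)
open import Relation.Binary.PropositionalEquality as ≡ using (_≡_; _≢_)

private
  variable
    c ℓ g ℓg m ℓm n ℓn x ρ : Level

-- A real number is a Cauchy sequence of rationals; two are equal when their difference is a
-- null sequence.

Small : (ℕ → ℕ → ℚ) → Set
Small f = ∀ ε → 0ℚ ℚ.< ε →
          ∃ λ N → ∀ i j → N ℕ.≤ i → N ℕ.≤ j → ℚ.∣ f i j ∣ ℚ.< ε

Null : (ℕ → ℚ) → Set
Null f = ∀ ε → 0ℚ ℚ.< ε → ∃ λ N → ∀ i → N ℕ.≤ i → ℚ.∣ f i ∣ ℚ.< ε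

IsCauchy : (ℕ → ℚ) → Set
IsCauchy s = Small (λ i j → s i ℚ.- s j)

record ℝ : Set where
  constructor _,_
  field
    seq    : ℕ → ℚ
    cauchy : IsCauchy seq
open ℝ

infix 4 _≈ℝ_

record _≈ℝ_ (a b : ℝ) : Set where
  constructor diff-null
  field
    null : Null (λ i → seq a i ℚ.- seq b i)
open _≈ℝ_

private
  Bounded : (ℕ → ℕ → ℚ) → Set
  Bounded f = ∃ λ B → 0ℚ ℚ.< B × ∃ λ N →
              ∀ i j → N ℕ.≤ i → N ℕ.≤ j → ℚ.∣ f i j ∣ ℚ.≤ B

  Small-ext : ∀ {f k} → (∀ i j → f i j ≡ k i j) → Small f → Small k
  Small-ext eq sf ε ε>0 with N , lt ← sf ε ε>0 =
    N , λ i j N≤i N≤j →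
      ≡.subst (λ z → ℚ.∣ z ∣ ℚ.< ε) (eq i j) (lt i j N≤i N≤j)

  Small-0 : ∀ {f} → (∀ i j → f i j ≡ 0ℚ) → Small f
  Small-0 eq = Small-ext (λ i j → ≡.sym (eq i j)) λ _ ε>0 → 0 , λ _ _ _ _ → ε>0

  Small-swap : ∀ {f} → Small f → Small (flip f)
  Small-swap sf ε ε>0 with N , lt ← sf ε ε>0 = N , λ i j N≤i N≤j → lt j i N≤j N≤i

  Small-neg : ∀ {f} → Small f → Small (λ i j → ℚ.- f i j)
  Small-neg {f} sf ε ε>0 with N , lt ← sf ε ε>0 =
    N , λ i j N≤i N≤j →
      ≡.subst (ℚ._< ε) (≡.sym (ℚ.∣-p∣≡∣p∣ (f i j))) (lt i j N≤i N≤j)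

  Small-+ : ∀ {f k} → Small f → Small k → Small (λ i j → f i j ℚ.+ k i j)
  Small-+ {f} {k} sf sk ε ε>0 = M ℕ.⊔ N , bound
    where
    ε/2 = ½ ℚ.* ε
    ε/2>0 : 0ℚ ℚ.< ε/2
    ε/2>0 = ≡.subst (ℚ._< ε/2) (ℚ.*-zeroʳ ½) (ℚ.*-monoʳ-<-pos ½ ε>0)
    M = proj₁ (sf ε/2 ε/2>0)
    N = proj₁ (sk ε/2 ε/2>0)
    halves : ε/2 ℚ.+ ε/2 ≡ ε
    halves = ≡.trans (≡.sym (ℚ.*-distribʳ-+ ε ½ ½)) (ℚ.*-identityˡ ε)
    bound : ∀ i j → M ℕ.⊔ N ℕ.≤ i → M ℕ.⊔ N ℕ.≤ j →
            ℚ.∣ f i j ℚ.+ k i j ∣ ℚ.< ε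
    bound i j i≥ j≥ = begin-strict
      ℚ.∣ f i j ℚ.+ k i j ∣          ≤⟨ ℚ.∣p+q∣≤∣p∣+∣q∣ (f i j) (k i j) ⟩
      ℚ.∣ f i j ∣ ℚ.+ ℚ.∣ k i j ∣    <⟨ ℚ.+-mono-<
        (proj₂ (sf ε/2 ε/2>0) i j (ℕ.m⊔n≤o⇒m≤o M N i≥) (ℕ.m⊔n≤o⇒m≤o M N j≥))
        (proj₂ (sk ε/2 ε/2>0) i j (ℕ.m⊔n≤o⇒n≤o M N i≥) (ℕ.m⊔n≤o⇒n≤o M N j≥)) ⟩
      ε/2 ℚ.+ ε/2                    ≡⟨ halves ⟩
      ε                              ∎
      where open ℚ.≤-Reasoning

  Small-* : ∀ {f k} → Bounded f → Small k → Small (λ i j → f i j ℚ.* k i j)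
  Small-* {f} {k} (B , B>0 , M , f≤B) sk ε ε>0 = M ℕ.⊔ N , bound
    where
    instance
      B-pos : ℚ.Positive B
      B-pos = ℚ.positive B>0
      B-nonZero : ℚ.NonZero B
      B-nonZero = ℚ.pos⇒nonZero B
      1/B-pos : ℚ.Positive (ℚ.1/ B)
      1/B-pos = ℚ.1/pos⇒pos B
    δ = (ℚ.1/ B) ℚ.* ε
    δ>0 : 0ℚ ℚ.< δ
    δ>0 = ≡.subst (ℚ._< δ) (ℚ.*-zeroʳ (ℚ.1/ B)) (ℚ.*-monoʳ-<-pos (ℚ.1/ B) ε>0)
    N = proj₁ (sk δ δ>0)
    Bδ≡ε : B ℚ.* δ ≡ ε
    Bδ≡ε = ≡.trans (≡.sym (ℚ.*-assoc B (ℚ.1/ B) ε))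
             (≡.trans (≡.cong (ℚ._* ε) (ℚ.*-inverseʳ B)) (ℚ.*-identityˡ ε))
    bound : ∀ i j → M ℕ.⊔ N ℕ.≤ i → M ℕ.⊔ N ℕ.≤ j →
            ℚ.∣ f i j ℚ.* k i j ∣ ℚ.< ε
    bound i j i≥ j≥ = begin-strict
      ℚ.∣ f i j ℚ.* k i j ∣          ≡⟨ ℚ.∣p*q∣≡∣p∣*∣q∣ (f i j) (k i j) ⟩
      ℚ.∣ f i j ∣ ℚ.* ℚ.∣ k i j ∣    ≤⟨ ℚ.*-monoʳ-≤-nonNeg ℚ.∣ k i j ∣ {{ℚ.∣-∣-nonNeg (k i j)}}
        (f≤B i j (ℕ.m⊔n≤o⇒m≤o M N i≥) (ℕ.m⊔n≤o⇒m≤o M N j≥)) ⟩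
      B ℚ.* ℚ.∣ k i j ∣              <⟨ ℚ.*-monoʳ-<-pos B
        (proj₂ (sk δ δ>0) i j (ℕ.m⊔n≤o⇒n≤o M N i≥) (ℕ.m⊔n≤o⇒n≤o M N j≥)) ⟩
      B ℚ.* δ                        ≡⟨ Bδ≡ε ⟩
      ε                              ∎
      where open ℚ.≤-Reasoning

  cauchy⇒bounded : ∀ a → Bounded (λ i _ → seq a i)
  cauchy⇒bounded a = B , B>0 , N , bound
    where
    s   = seq a
    0<1 : 0ℚ ℚ.< 1ℚ
    0<1 = ℚ.positive⁻¹ 1ℚ
    N   = proj₁ (cauchy a 1ℚ 0<1)
    B   = 1ℚ ℚ.+ ℚ.∣ s N ∣
    B>0 : 0ℚ ℚ.< B
    B>0 = ℚ.+-mono-<-≤ 0<1 (ℚ.0≤∣p∣ (s N))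
    split : ∀ u v → u ≡ (u ℚ.- v) ℚ.+ v
    split = solve 2 (λ u v → u := (u :- v) :+ v) ≡.refl
      where open ℚ.+-*-Solver
    bound : ∀ i j → N ℕ.≤ i → N ℕ.≤ j → ℚ.∣ s i ∣ ℚ.≤ B
    bound i _ N≤i _ = begin
      ℚ.∣ s i ∣                            ≡⟨ ≡.cong ℚ.∣_∣ (split (s i) (s N)) ⟩
      ℚ.∣ (s i ℚ.- s N) ℚ.+ s N ∣          ≤⟨ ℚ.∣p+q∣≤∣p∣+∣q∣ (s i ℚ.- s N) (s N) ⟩
      ℚ.∣ s i ℚ.- s N ∣ ℚ.+ ℚ.∣ s N ∣      ≤⟨ ℚ.+-monoˡ-≤ ℚ.∣ s N ∣
        (ℚ.<⇒≤ (proj₂ (cauchy a 1ℚ 0<1) i N N≤i ℕ.≤-refl)) ⟩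
      B                                    ∎
      where open ℚ.≤-Reasoning

  bounded-swap : ∀ {f} → Bounded f → Bounded (flip f)
  bounded-swap (B , B>0 , N , le) = B , B>0 , N , λ i j N≤i N≤j → le j i N≤j N≤i

  small : ∀ {a b} → a ≈ℝ b → Small (λ i _ → seq a i ℚ.- seq b i)
  small a≈b ε ε>0 with N , lt ← null a≈b ε ε>0 = N , λ i _ N≤i _ → lt i N≤i

  small⁻¹ : ∀ {a b} → Small (λ i _ → seq a i ℚ.- seq b i) → a ≈ℝ b
  small⁻¹ s = diff-null λ ε ε>0 → let (N , lt) = s ε ε>0 in
    N , λ i N≤i → lt i i N≤i N≤i

  pointwise : ∀ {a b} → (∀ i → seq a i ≡ seq b i) → a ≈ℝ b
  pointwise {a} {b} eq = small⁻¹ (Small-0 λ i _ →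
    ≡.trans (≡.cong (ℚ._- seq b i) (eq i)) (ℚ.+-inverseʳ (seq b i)))

  add-sub : ∀ u v w z → (u ℚ.- w) ℚ.+ (v ℚ.- z) ≡ (u ℚ.+ v) ℚ.- (w ℚ.+ z)
  add-sub = solve 4 (λ u v w z → (u :- w) :+ (v :- z) := (u :+ v) :- (w :+ z)) ≡.refl
    where open ℚ.+-*-Solver

  neg-sub : ∀ u v → ℚ.- (u ℚ.- v) ≡ ℚ.- u ℚ.- ℚ.- v
  neg-sub = solve 2 (λ u v → :- (u :- v) := :- u :- :- v) ≡.refl
    where open ℚ.+-*-Solver

  mul-sub : ∀ u v w z →
            u ℚ.* (v ℚ.- z) ℚ.+ z ℚ.* (u ℚ.- w) ≡ u ℚ.* v ℚ.- w ℚ.* z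
  mul-sub = solve 4 (λ u v w z → u :* (v :- z) :+ z :* (u :- w) := u :* v :- w :* z) ≡.refl
    where open ℚ.+-*-Solver

infixl 6 _+ℝ_
infixl 7 _*ℝ_
infix  8 -ℝ_

private abstract
  +-cauchy : ∀ a b → IsCauchy (λ i → seq a i ℚ.+ seq b i)
  +-cauchy a b =
    Small-ext (λ i j → add-sub (seq a i) (seq b i) (seq a j) (seq b j))
      (Small-+ (cauchy a) (cauchy b))

  *-cauchy : ∀ a b → IsCauchy (λ i → seq a i ℚ.* seq b i)
  *-cauchy a b =
    Small-ext (λ i j → mul-sub (seq a i) (seq b i) (seq a j) (seq b j))
      (Small-+ (Small-* (cauchy⇒bounded a) (cauchy b))
               (Small-* (bounded-swap (cauchy⇒bounded b)) (cauchy a)))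

  neg-cauchy : ∀ a → IsCauchy (λ i → ℚ.- seq a i)
  neg-cauchy a = Small-ext (λ i j → neg-sub (seq a i) (seq a j)) (Small-neg (cauchy a))

  const-cauchy : ∀ r → IsCauchy (λ _ → r)
  const-cauchy r = Small-0 λ _ _ → ℚ.+-inverseʳ r

_+ℝ_ _*ℝ_ : ℝ → ℝ → ℝ
a +ℝ b = (λ i → seq a i ℚ.+ seq b i) , +-cauchy a b
a *ℝ b = (λ i → seq a i ℚ.* seq b i) , *-cauchy a b

-ℝ_ : ℝ → ℝ
-ℝ a = (λ i → ℚ.- seq a i) , neg-cauchy a

fromℚ : ℚ → ℝ
fromℚ r = (λ _ → r) , const-cauchy r

private
  ≈ℝ-refl : ∀ {a} → a ≈ℝ a
  ≈ℝ-refl = pointwise λ _ → ≡.refl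

  ≈ℝ-sym : ∀ {a b} → a ≈ℝ b → b ≈ℝ a
  ≈ℝ-sym {a} {b} a≈b = small⁻¹
    (Small-ext (λ i _ → neg-swap (seq a i) (seq b i)) (Small-neg (small a≈b)))
    where
    neg-swap : ∀ u v → ℚ.- (u ℚ.- v) ≡ v ℚ.- u
    neg-swap = solve 2 (λ u v → :- (u :- v) := v :- u) ≡.refl
      where open ℚ.+-*-Solver

  ≈ℝ-trans : ∀ {a b d} → a ≈ℝ b → b ≈ℝ d → a ≈ℝ d
  ≈ℝ-trans {a} {b} {d} a≈b b≈d = small⁻¹
    (Small-ext (λ i _ → telescope (seq a i) (seq b i) (seq d i))
      (Small-+ (small a≈b) (small b≈d)))
    where
    telescope : ∀ u v w → (u ℚ.- v) ℚ.+ (v ℚ.- w) ≡ u ℚ.- w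
    telescope = solve 3 (λ u v w → (u :- v) :+ (v :- w) := u :- w) ≡.refl
      where open ℚ.+-*-Solver

  +ℝ-cong : ∀ {a b d e} → a ≈ℝ b → d ≈ℝ e → a +ℝ d ≈ℝ b +ℝ e
  +ℝ-cong {a} {b} {d} {e} a≈b d≈e = small⁻¹
    (Small-ext (λ i _ → add-sub (seq a i) (seq d i) (seq b i) (seq e i))
      (Small-+ (small a≈b) (small d≈e)))

  -ℝ-cong : ∀ {a b} → a ≈ℝ b → -ℝ a ≈ℝ -ℝ b
  -ℝ-cong {a} {b} a≈b = small⁻¹
    (Small-ext (λ i _ → neg-sub (seq a i) (seq b i)) (Small-neg (small a≈b)))

  *ℝ-cong : ∀ {a b d e} → a ≈ℝ b → d ≈ℝ e → a *ℝ d ≈ℝ b *ℝ e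
  *ℝ-cong {a} {b} {d} {e} a≈b d≈e = small⁻¹
    (Small-ext (λ i _ → mul-sub (seq a i) (seq d i) (seq b i) (seq e i))
      (Small-+ (Small-* (cauchy⇒bounded a) (small d≈e))
               (Small-* (cauchy⇒bounded e) (small a≈b))))

  +ℝ-assoc : ∀ a b d → (a +ℝ b) +ℝ d ≈ℝ a +ℝ (b +ℝ d)
  +ℝ-assoc a b d = pointwise λ i → ℚ.+-assoc (seq a i) (seq b i) (seq d i)

  +ℝ-comm : ∀ a b → a +ℝ b ≈ℝ b +ℝ a
  +ℝ-comm a b = pointwise λ i → ℚ.+-comm (seq a i) (seq b i)

  +ℝ-identityˡ : ∀ a → fromℚ 0ℚ +ℝ a ≈ℝ a
  +ℝ-identityˡ a = pointwise λ i → ℚ.+-identityˡ (seq a i)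

  -ℝ-inverseˡ : ∀ a → -ℝ a +ℝ a ≈ℝ fromℚ 0ℚ
  -ℝ-inverseˡ a = pointwise λ i → ℚ.+-inverseˡ (seq a i)

  *ℝ-assoc : ∀ a b d → (a *ℝ b) *ℝ d ≈ℝ a *ℝ (b *ℝ d)
  *ℝ-assoc a b d = pointwise λ i → ℚ.*-assoc (seq a i) (seq b i) (seq d i)

  *ℝ-comm : ∀ a b → a *ℝ b ≈ℝ b *ℝ a
  *ℝ-comm a b = pointwise λ i → ℚ.*-comm (seq a i) (seq b i)

  *ℝ-identityˡ : ∀ a → fromℚ 1ℚ *ℝ a ≈ℝ a
  *ℝ-identityˡ a = pointwise λ i → ℚ.*-identityˡ (seq a i)

  *ℝ-distribˡ : ∀ a b d → a *ℝ (b +ℝ d) ≈ℝ a *ℝ b +ℝ a *ℝ d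
  *ℝ-distribˡ a b d = pointwise λ i → ℚ.*-distribˡ-+ (seq a i) (seq b i) (seq d i)

ℝ-commutativeRing : CommutativeRing 0ℓ 0ℓ
ℝ-commutativeRing = record
  { Carrier = ℝ ; _≈_ = _≈ℝ_
  ; _+_ = _+ℝ_ ; _*_ = _*ℝ_ ; -_ = -ℝ_ ; 0# = fromℚ 0ℚ ; 1# = fromℚ 1ℚ
  ; isCommutativeRing = record
    { isRing = record
      { +-isAbelianGroup = record
        { isGroup = record
          { isMonoid = record
            { isSemigroup = record
              { isMagma = record
                { isEquivalence = record
                  { refl = ≈ℝ-refl ; sym = ≈ℝ-sym ; trans = ≈ℝ-trans }
                ; ∙-cong = +ℝ-cong }
              ; assoc = +ℝ-assoc }
            ; identity = +ℝ-identityˡ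
                       , (λ a → ≈ℝ-trans (+ℝ-comm a _) (+ℝ-identityˡ a)) }
          ; inverse = -ℝ-inverseˡ
                    , (λ a → ≈ℝ-trans (+ℝ-comm a _) (-ℝ-inverseˡ a))
          ; ⁻¹-cong = -ℝ-cong }
        ; comm = +ℝ-comm }
      ; *-cong = *ℝ-cong
      ; *-assoc = *ℝ-assoc
      ; *-identity = *ℝ-identityˡ
                   , (λ a → ≈ℝ-trans (*ℝ-comm a _) (*ℝ-identityˡ a))
      ; distrib = *ℝ-distribˡ
                , (λ a b d → ≈ℝ-trans (*ℝ-comm (b +ℝ d) a)
                    (≈ℝ-trans (*ℝ-distribˡ a b d) (+ℝ-cong (*ℝ-comm a b) (*ℝ-comm a d))))
      }
    ; *-comm = *ℝ-comm } }

-- a +i b is the complex number a + bi.  Nothing below refers to inverses, so only the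
-- commutative-ring structure of the field ℂ is recorded.

record ℂ : Set where
  constructor _+i_
  field
    re im : ℝ
open ℂ

infix 4 _≈ℂ_

record _≈ℂ_ (z w : ℂ) : Set where
  constructor _,_
  field
    re-≈ : re z ≈ℝ re w
    im-≈ : im z ≈ℝ im w

infixl 6 _+ℂ_
infixl 7 _*ℂ_
infix  8 -ℂ_

_+ℂ_ _*ℂ_ : ℂ → ℂ → ℂ
(a +i b) +ℂ (d +i e) = (a +ℝ d) +i (b +ℝ e)
(a +i b) *ℂ (d +i e) = (a *ℝ d +ℝ -ℝ (b *ℝ e)) +i (a *ℝ e +ℝ b *ℝ d)

-ℂ_ : ℂ → ℂ
-ℂ (a +i b) = (-ℝ a) +i (-ℝ b)

0ℂ 1ℂ : ℂ
0ℂ = fromℚ 0ℚ +i fromℚ 0ℚ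
1ℂ = fromℚ 1ℚ +i fromℚ 0ℚ

private
  module Identities {c ℓ} (R : CommutativeRing c ℓ) where
    open CommutativeRing R
    open import Algebra.Properties.Ring ring using (-‿distribˡ-*; -‿distribʳ-*; -‿+-comm)
    open import Algebra.Properties.CommutativeSemigroup
      (CommutativeRing.+-commutativeSemigroup R) using (interchange)
    open import Relation.Binary.Reasoning.Setoid setoid

    swap-tail : ∀ s t u v → (s + t) + (u + v) ≈ (s + u) + (v + t)
    swap-tail s t u v = trans (interchange s t u v) (+-congˡ (+-comm t v))

    assoc-re : ∀ a b d e f k →
      (a * d + - (b * e)) * f + - ((a * e + b * d) * k) ≈
      a * (d * f + - (e * k)) + - (b * (d * k + e * f))
    assoc-re a b d e f k = begin
      (a * d + - (b * e)) * f + - ((a * e + b * d) * k)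
        ≈⟨ +-cong
             (trans (distribʳ f (a * d) (- (b * e)))
               (+-cong (*-assoc a d f)
                 (trans (sym (-‿distribˡ-* (b * e) f)) (-‿cong (*-assoc b e f)))))
             (trans (-‿cong (distribʳ k (a * e) (b * d)))
               (trans (sym (-‿+-comm _ _))
                 (+-cong (-‿cong (*-assoc a e k)) (-‿cong (*-assoc b d k))))) ⟩
      (a * (d * f) + - (b * (e * f))) + (- (a * (e * k)) + - (b * (d * k)))
        ≈⟨ swap-tail _ _ _ _ ⟩
      (a * (d * f) + - (a * (e * k))) + (- (b * (d * k)) + - (b * (e * f)))
        ≈⟨ +-cong
             (trans (distribˡ a (d * f) (- (e * k))) (+-congˡ (sym (-‿distribʳ-* a (e * k)))))
             (trans (-‿cong (distribˡ b (d * k) (e * f))) (sym (-‿+-comm _ _))) ⟨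
      a * (d * f + - (e * k)) + - (b * (d * k + e * f)) ∎

    assoc-im : ∀ a b d e f k →
      (a * d + - (b * e)) * k + (a * e + b * d) * f ≈
      a * (d * k + e * f) + b * (d * f + - (e * k))
    assoc-im a b d e f k = begin
      (a * d + - (b * e)) * k + (a * e + b * d) * f
        ≈⟨ +-cong
             (trans (distribʳ k (a * d) (- (b * e)))
               (+-cong (*-assoc a d k)
                 (trans (sym (-‿distribˡ-* (b * e) k)) (-‿cong (*-assoc b e k)))))
             (trans (distribʳ f (a * e) (b * d)) (+-cong (*-assoc a e f) (*-assoc b d f))) ⟩
      (a * (d * k) + - (b * (e * k))) + (a * (e * f) + b * (d * f))
        ≈⟨ swap-tail _ _ _ _ ⟩
      (a * (d * k) + a * (e * f)) + (b * (d * f) + - (b * (e * k)))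
        ≈⟨ +-cong (distribˡ a (d * k) (e * f))
             (trans (distribˡ b (d * f) (- (e * k))) (+-congˡ (sym (-‿distribʳ-* b (e * k))))) ⟨
      a * (d * k + e * f) + b * (d * f + - (e * k)) ∎

    distribˡ-re : ∀ a b d e f k →
      a * (d + f) + - (b * (e + k)) ≈ (a * d + - (b * e)) + (a * f + - (b * k))
    distribˡ-re a b d e f k = trans
      (+-cong (distribˡ a d f) (trans (-‿cong (distribˡ b e k)) (sym (-‿+-comm _ _))))
      (interchange _ _ _ _)

    distribˡ-im : ∀ a b d e f k →
      a * (e + k) + b * (d + f) ≈ (a * e + b * d) + (a * k + b * f)
    distribˡ-im a b d e f k = trans
      (+-cong (distribˡ a e k) (distribˡ b d f)) (interchange _ _ _ _)

  module R = CommutativeRing ℝ-commutativeRing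
  module I = Identities ℝ-commutativeRing

  *ℂ-comm : ∀ z w → z *ℂ w ≈ℂ w *ℂ z
  *ℂ-comm (a +i b) (d +i e) =
      R.+-cong (R.*-comm a d) (R.-‿cong (R.*-comm b e))
    , R.trans (R.+-cong (R.*-comm a e) (R.*-comm b d)) (R.+-comm (e *ℝ a) (d *ℝ b))

  ≈ℂ-trans : ∀ {z w v} → z ≈ℂ w → w ≈ℂ v → z ≈ℂ v
  ≈ℂ-trans (p , q) (r , s) = R.trans p r , R.trans q s

  +ℂ-cong : ∀ {z w u v} → z ≈ℂ w → u ≈ℂ v → z +ℂ u ≈ℂ w +ℂ v
  +ℂ-cong (p , q) (r , s) = R.+-cong p r , R.+-cong q s

  *ℂ-cong : ∀ {z w u v} → z ≈ℂ w → u ≈ℂ v → z *ℂ u ≈ℂ w *ℂ v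
  *ℂ-cong (p , q) (r , s) =
      R.+-cong (R.*-cong p r) (R.-‿cong (R.*-cong q s))
    , R.+-cong (R.*-cong p s) (R.*-cong q r)

  *ℂ-identityˡ : ∀ z → 1ℂ *ℂ z ≈ℂ z
  *ℂ-identityˡ (a +i b) =
      pointwise (λ i → one-re (seq a i) (seq b i))
    , pointwise (λ i → one-im (seq a i) (seq b i))
    where
    open ℚ.+-*-Solver
    one-re : ∀ u v → 1ℚ ℚ.* u ℚ.+ ℚ.- (0ℚ ℚ.* v) ≡ u
    one-re = solve 2 (λ u v → con 1ℚ :* u :+ :- (con 0ℚ :* v) := u) ≡.refl
    one-im : ∀ u v → 1ℚ ℚ.* v ℚ.+ 0ℚ ℚ.* u ≡ v
    one-im = solve 2 (λ u v → con 1ℚ :* v :+ con 0ℚ :* u := v) ≡.refl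

  *ℂ-assoc : ∀ z w v → (z *ℂ w) *ℂ v ≈ℂ z *ℂ (w *ℂ v)
  *ℂ-assoc (a +i b) (d +i e) (f +i k) =
      I.assoc-re a b d e f k
    , I.assoc-im a b d e f k

  *ℂ-distribˡ : ∀ z w v → z *ℂ (w +ℂ v) ≈ℂ z *ℂ w +ℂ z *ℂ v
  *ℂ-distribˡ (a +i b) (d +i e) (f +i k) =
      I.distribˡ-re a b d e f k
    , I.distribˡ-im a b d e f k

ℂ-commutativeRing : CommutativeRing 0ℓ 0ℓ
ℂ-commutativeRing = record
  { Carrier = ℂ ; _≈_ = _≈ℂ_
  ; _+_ = _+ℂ_ ; _*_ = _*ℂ_ ; -_ = -ℂ_ ; 0# = 0ℂ ; 1# = 1ℂ
  ; isCommutativeRing = record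
    { isRing = record
      { +-isAbelianGroup = record
        { isGroup = record
          { isMonoid = record
            { isSemigroup = record
              { isMagma = record
                { isEquivalence = record
                  { refl  = R.refl , R.refl
                  ; sym   = λ (p , q) → R.sym p , R.sym q
                  ; trans = ≈ℂ-trans }
                ; ∙-cong = +ℂ-cong }
              ; assoc = λ (a +i b) (d +i e) (f +i k) → R.+-assoc a d f , R.+-assoc b e k }
            ; identity = (λ (a +i b) → R.+-identityˡ a , R.+-identityˡ b)
                       , (λ (a +i b) → R.+-identityʳ a , R.+-identityʳ b) }
          ; inverse = (λ (a +i b) → R.-‿inverseˡ a , R.-‿inverseˡ b)
                    , (λ (a +i b) → R.-‿inverseʳ a , R.-‿inverseʳ b)
          ; ⁻¹-cong = λ (p , q) → R.-‿cong p , R.-‿cong q }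
        ; comm = λ (a +i b) (d +i e) → R.+-comm a d , R.+-comm b e }
      ; *-cong = *ℂ-cong
      ; *-assoc = *ℂ-assoc
      ; *-identity = *ℂ-identityˡ
                   , (λ z → ≈ℂ-trans (*ℂ-comm z 1ℂ) (*ℂ-identityˡ z))
      ; distrib = *ℂ-distribˡ
                , (λ z w v → ≈ℂ-trans (*ℂ-comm (w +ℂ v) z)
                    (≈ℂ-trans (*ℂ-distribˡ z w v) (+ℂ-cong (*ℂ-comm z w) (*ℂ-comm z v))))
      }
    ; *-comm = *ℂ-comm } }

module _ {K : CommutativeRing c ℓ} (M : Module K m ℓm) where
  private
    module K = CommutativeRing K
  open Module M
  open Sum +ᴹ-monoid using (sum)

  record IsBasis {d : ℕ} (b : Vector Carrierᴹ d) : Set (c ⊔ ℓ ⊔ m ⊔ ℓm) where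
    field
      independent : ∀ (r : Vector K.Carrier d) →
                    sum (λ i → r i *ₗ b i) ≈ᴹ 0ᴹ → ∀ i → r i K.≈ K.0#
      spanning    : ∀ v → ∃ λ (r : Vector K.Carrier d) → v ≈ᴹ sum (λ i → r i *ₗ b i)

  HasDimension : ℕ → Set (c ⊔ ℓ ⊔ m ⊔ ℓm)
  HasDimension d = ∃ λ (b : Vector Carrierᴹ d) → IsBasis b

module _ (K : CommutativeRing c ℓ) where
  private
    module K = CommutativeRing K

  infixl 6 _⊕_
  infixr 7 _⊙_

  data Comb (X : Set x) : Set (c ⊔ x) where
    gen : X → Comb X
    𝟘   : Comb X
    _⊕_ : Comb X → Comb X → Comb X
    _⊙_ : K.Carrier → Comb X → Comb X

  mapComb : {X : Set x} {Y : Set m} → (X → Y) → Comb X → Comb Y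
  mapComb f (gen a) = gen (f a)
  mapComb f 𝟘       = 𝟘
  mapComb f (s ⊕ t) = mapComb f s ⊕ mapComb f t
  mapComb f (r ⊙ s) = r ⊙ mapComb f s

  -- The least congruence on formal combinations that contains Q and satisfies the
  -- module axioms.
  data Generated {X : Set x} (Q : Rel (Comb X) ρ) : Rel (Comb X) (c ⊔ ℓ ⊔ x ⊔ ρ) where
    rel       : ∀ {s t} → Q s t → Generated Q s t
    ~-refl    : ∀ {s} → Generated Q s s
    ~-sym     : ∀ {s t} → Generated Q s t → Generated Q t s
    ~-trans   : ∀ {s t u} → Generated Q s t → Generated Q t u → Generated Q s u
    ⊕-cong    : ∀ {s s′ t t′} → Generated Q s s′ → Generated Q t t′ →
                Generated Q (s ⊕ t) (s′ ⊕ t′)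
    ⊙-cong    : ∀ {r r′ s s′} → r K.≈ r′ → Generated Q s s′ →
                Generated Q (r ⊙ s) (r′ ⊙ s′)
    ⊕-assoc   : ∀ s t u → Generated Q ((s ⊕ t) ⊕ u) (s ⊕ (t ⊕ u))
    ⊕-comm    : ∀ s t → Generated Q (s ⊕ t) (t ⊕ s)
    ⊕-identityˡ : ∀ s → Generated Q (𝟘 ⊕ s) s
    ⊙-distribˡ : ∀ r s t → Generated Q (r ⊙ (s ⊕ t)) (r ⊙ s ⊕ r ⊙ t)
    ⊙-distribʳ : ∀ s r r′ → Generated Q ((r K.+ r′) ⊙ s) (r ⊙ s ⊕ r′ ⊙ s)
    ⊙-assoc    : ∀ r r′ s → Generated Q ((r K.* r′) ⊙ s) (r ⊙ (r′ ⊙ s))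
    ⊙-identity : ∀ s → Generated Q (K.1# ⊙ s) s
    ⊙-zeroˡ    : ∀ s → Generated Q (K.0# ⊙ s) 𝟘
    ⊙-zeroʳ    : ∀ r → Generated Q (r ⊙ 𝟘) 𝟘

  Presented : {X : Set x} → Rel (Comb X) ρ → Module K (c ⊔ x) (c ⊔ ℓ ⊔ x ⊔ ρ)
  Presented {X = X} Q = record
    { Carrierᴹ = Comb X ; _≈ᴹ_ = Generated Q
    ; _+ᴹ_ = _⊕_ ; _*ₗ_ = _⊙_ ; _*ᵣ_ = flip _⊙_ ; 0ᴹ = 𝟘 ; -ᴹ_ = (K.- K.1#) ⊙_
    ; isModule = IsModuleFromLeft.isModule {commutativeRing = K} record
      { isLeftModule = record
        { isLeftSemimodule = record
          { +ᴹ-isCommutativeMonoid = record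
            { isMonoid = record
              { isSemigroup = record
                { isMagma = record
                  { isEquivalence = record { refl = ~-refl ; sym = ~-sym ; trans = ~-trans }
                  ; ∙-cong = ⊕-cong }
                ; assoc = ⊕-assoc }
              ; identity = ⊕-identityˡ
                         , (λ s → ~-trans (⊕-comm s 𝟘) (⊕-identityˡ s)) }
            ; comm = ⊕-comm }
          ; isPreleftSemimodule = record
            { *ₗ-cong = ⊙-cong
            ; *ₗ-zeroˡ = ⊙-zeroˡ
            ; *ₗ-distribʳ = ⊙-distribʳ
            ; *ₗ-identityˡ = ⊙-identity
            ; *ₗ-assoc = ⊙-assoc
            ; *ₗ-zeroʳ = ⊙-zeroʳ
            ; *ₗ-distribˡ = ⊙-distribˡ } }
        ; -ᴹ‿cong = ⊙-cong K.refl
        ; -ᴹ‿inverse = inverseˡ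
                     , (λ s → ~-trans (⊕-comm s _) (inverseˡ s)) } } }
    where
    inverseˡ : ∀ s → Generated Q ((K.- K.1#) ⊙ s ⊕ s) 𝟘
    inverseˡ s = ~-trans (⊕-cong ~-refl (~-sym (⊙-identity s)))
      (~-trans (~-sym (⊙-distribʳ s (K.- K.1#) K.1#))
        (~-trans (⊙-cong (K.-‿inverseˡ K.1#) ~-refl) (⊙-zeroˡ s)))

  mapComb-cong : {X : Set x} {Y : Set m} {Q : Rel (Comb X) ρ} {Q′ : Rel (Comb Y) ℓm}
                 (f : X → Y) →
                 (∀ {s t} → Q s t → Generated Q′ (mapComb f s) (mapComb f t)) →
                 ∀ {s t} → Generated Q s t → Generated Q′ (mapComb f s) (mapComb f t)
  mapComb-cong f resp (rel e)        = resp e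
  mapComb-cong f resp ~-refl         = ~-refl
  mapComb-cong f resp (~-sym e)      = ~-sym (mapComb-cong f resp e)
  mapComb-cong f resp (~-trans e e′) = ~-trans (mapComb-cong f resp e) (mapComb-cong f resp e′)
  mapComb-cong f resp (⊕-cong e e′)  = ⊕-cong (mapComb-cong f resp e) (mapComb-cong f resp e′)
  mapComb-cong f resp (⊙-cong r e)   = ⊙-cong r (mapComb-cong f resp e)
  mapComb-cong f resp (⊕-assoc _ _ _)    = ⊕-assoc _ _ _
  mapComb-cong f resp (⊕-comm _ _)       = ⊕-comm _ _
  mapComb-cong f resp (⊕-identityˡ _)    = ⊕-identityˡ _
  mapComb-cong f resp (⊙-distribˡ _ _ _) = ⊙-distribˡ _ _ _
  mapComb-cong f resp (⊙-distribʳ _ _ _) = ⊙-distribʳ _ _ _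
  mapComb-cong f resp (⊙-assoc _ _ _)    = ⊙-assoc _ _ _
  mapComb-cong f resp (⊙-identity _)     = ⊙-identity _
  mapComb-cong f resp (⊙-zeroˡ _)        = ⊙-zeroˡ _
  mapComb-cong f resp (⊙-zeroʳ _)        = ⊙-zeroʳ _

module _ {K : CommutativeRing c ℓ} (V : Module K m ℓm) where
  private
    module K = CommutativeRing K
    module V = Module V

  -- The p-fold tensor power: gen v stands for v₀ ⊗ ⋯ ⊗ vₚ₋₁.  In add and scale the
  -- vectors agree away from the position i.
  data Multilinear (p : ℕ) : Rel (Comb K (Vector V.Carrierᴹ p)) (c ⊔ m ⊔ ℓm) where
    cong  : ∀ {v w} → (∀ i → v i V.≈ᴹ w i) → Multilinear p (gen v) (gen w)
    add   : ∀ i {u v w} → w i V.≈ᴹ (u i V.+ᴹ v i) →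
            (∀ j → j ≢ i → w j V.≈ᴹ u j) → (∀ j → j ≢ i → w j V.≈ᴹ v j) →
            Multilinear p (gen w) (gen u ⊕ gen v)
    scale : ∀ i r {v w} → w i V.≈ᴹ (r V.*ₗ v i) →
            (∀ j → j ≢ i → w j V.≈ᴹ v j) →
            Multilinear p (gen w) (r ⊙ gen v)

  data Symmetric (p : ℕ) : Rel (Comb K (Vector V.Carrierᴹ p)) (c ⊔ m ⊔ ℓm) where
    multilinear : ∀ {s t} → Multilinear p s t → Symmetric p s t
    permute     : ∀ (π : Permutation′ p) v →
                  Symmetric p (gen (v ∘ (π ⟨$⟩ʳ_))) (gen v)

  data Alternating (p : ℕ) : Rel (Comb K (Vector V.Carrierᴹ p)) (c ⊔ m ⊔ ℓm) where
    multilinear : ∀ {s t} → Multilinear p s t → Alternating p s t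
    repeated    : ∀ {i j} v → i ≢ j → v i V.≈ᴹ v j → Alternating p (gen v) 𝟘

  SymmetricPower ExteriorPower : ℕ → Module K (c ⊔ m) (c ⊔ ℓ ⊔ m ⊔ ℓm)
  SymmetricPower p = Presented K (Symmetric p)
  ExteriorPower  p = Presented K (Alternating p)

module _ {K : CommutativeRing c ℓ} (V : Module K m ℓm) (W : Module K n ℓn) where
  private
    module K = CommutativeRing K
    module V = Module V
    module W = Module W

  data Bilinear : Rel (Comb K (V.Carrierᴹ × W.Carrierᴹ)) (c ⊔ m ⊔ ℓm ⊔ n ⊔ ℓn) where
    cong   : ∀ {v v′ w w′} → v V.≈ᴹ v′ → w W.≈ᴹ w′ →
             Bilinear (gen (v , w)) (gen (v′ , w′))
    addˡ   : ∀ v v′ w → Bilinear (gen (v V.+ᴹ v′ , w)) (gen (v , w) ⊕ gen (v′ , w))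
    addʳ   : ∀ v w w′ → Bilinear (gen (v , w W.+ᴹ w′)) (gen (v , w) ⊕ gen (v , w′))
    scaleˡ : ∀ r v w → Bilinear (gen (r V.*ₗ v , w)) (r ⊙ gen (v , w))
    scaleʳ : ∀ r v w → Bilinear (gen (v , r W.*ₗ w)) (r ⊙ gen (v , w))

  Tensor : Module K (c ⊔ m ⊔ n) (c ⊔ ℓ ⊔ m ⊔ ℓm ⊔ n ⊔ ℓn)
  Tensor = Presented K Bilinear

record Representation (K : CommutativeRing c ℓ) (G : Group g ℓg) (m ℓm : Level) :
                      Set (c ⊔ ℓ ⊔ g ⊔ ℓg ⊔ lsuc (m ⊔ ℓm)) where
  private
    module G = Group G
  field
    space : Module K m ℓm
  open Module space
  field
    act        : G.Carrier → Carrierᴹ → Carrierᴹ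
    act-linear : ∀ a → IsModuleHomomorphism rawModule rawModule (act a)
    act-cong   : ∀ {a b} → a G.≈ b → ∀ v → act a v ≈ᴹ act b v
    act-ε      : ∀ v → act G.ε v ≈ᴹ v
    act-∙      : ∀ a b v → act (a G.∙ b) v ≈ᴹ act a (act b v)

  module act-linear (a : G.Carrier) = IsModuleHomomorphism (act-linear a)

module _ {K : CommutativeRing c ℓ} {G : Group g ℓg} where
  private
    module K = CommutativeRing K
    module G = Group G

  presentedRep : {X : Set x} (Q : Rel (Comb K X) ρ) (f : G.Carrier → X → X) →
    (∀ a {s t} → Q s t → Generated K Q (mapComb K (f a) s) (mapComb K (f a) t)) →
    (∀ {a b} → a G.≈ b → ∀ y → Generated K Q (gen (f a y)) (gen (f b y))) →
    (∀ y → Generated K Q (gen (f G.ε y)) (gen y)) →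
    (∀ a b y → Generated K Q (gen (f (a G.∙ b) y)) (gen (f a (f b y)))) →
    Representation K G (c ⊔ x) (c ⊔ ℓ ⊔ x ⊔ ρ)
  presentedRep {X = X} Q f resp f-cong f-ε f-∙ = record
    { space      = Presented K Q
    ; act        = λ a → mapComb K (f a)
    ; act-linear = λ a → record
      { isBimoduleHomomorphism = record
        { +ᴹ-isGroupHomomorphism = record
          { isMonoidHomomorphism = record
            { isMagmaHomomorphism = record
              { isRelHomomorphism = record { cong = mapComb-cong K (f a) (resp a) }
              ; homo = λ _ _ → ~-refl }
            ; ε-homo = ~-refl }
          ; ⁻¹-homo = λ _ → ~-refl }
        ; *ₗ-homo = λ _ _ → ~-refl
        ; *ᵣ-homo = λ _ _ → ~-refl } }
    ; act-cong   = act-cong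
    ; act-ε      = act-ε
    ; act-∙      = act-∙ }
    where
    act-cong : ∀ {a b} → a G.≈ b → ∀ s → Generated K Q (mapComb K (f a) s) (mapComb K (f b) s)
    act-cong e (gen y) = f-cong e y
    act-cong e 𝟘       = ~-refl
    act-cong e (s ⊕ t) = ⊕-cong (act-cong e s) (act-cong e t)
    act-cong e (r ⊙ s) = ⊙-cong K.refl (act-cong e s)

    act-ε : ∀ s → Generated K Q (mapComb K (f G.ε) s) s
    act-ε (gen y) = f-ε y
    act-ε 𝟘       = ~-refl
    act-ε (s ⊕ t) = ⊕-cong (act-ε s) (act-ε t)
    act-ε (r ⊙ s) = ⊙-cong K.refl (act-ε s)

    act-∙ : ∀ a b s →
      Generated K Q (mapComb K (f (a G.∙ b)) s) (mapComb K (f a) (mapComb K (f b) s))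
    act-∙ a b (gen y) = f-∙ a b y
    act-∙ a b 𝟘       = ~-refl
    act-∙ a b (s ⊕ t) = ⊕-cong (act-∙ a b s) (act-∙ a b t)
    act-∙ a b (r ⊙ s) = ⊙-cong K.refl (act-∙ a b s)

  module _ (V : Representation K G m ℓm) where
    private
      module V = Representation V
      module S = Module V.space
      module L = V.act-linear

      act-multilinear : ∀ {p} a {s t} → Multilinear V.space p s t →
        Multilinear V.space p (mapComb K (V.act a ∘_) s) (mapComb K (V.act a ∘_) t)
      act-multilinear a (cong e) = cong (λ i → L.⟦⟧-cong a (e i))
      act-multilinear a (add i e e′ e″) =
        add i (S.≈ᴹ-trans (L.⟦⟧-cong a e) (L.+ᴹ-homo a _ _))
          (λ j j≢i → L.⟦⟧-cong a (e′ j j≢i)) (λ j j≢i → L.⟦⟧-cong a (e″ j j≢i))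
      act-multilinear a (scale i r e e′) =
        scale i r (S.≈ᴹ-trans (L.⟦⟧-cong a e) (L.*ₗ-homo a r _))
          (λ j j≢i → L.⟦⟧-cong a (e′ j j≢i))

    𝒮 ⋀ : ℕ → Representation K G (c ⊔ m) (c ⊔ ℓ ⊔ m ⊔ ℓm)
    𝒮 p = presentedRep (Symmetric V.space p) (λ a → V.act a ∘_)
      (λ { a (multilinear e) → rel (multilinear (act-multilinear a e))
         ; a (permute π v)   → rel (permute π (V.act a ∘ v)) })
      (λ e v   → rel (multilinear (cong λ i → V.act-cong e (v i))))
      (λ v     → rel (multilinear (cong λ i → V.act-ε (v i))))
      (λ a b v → rel (multilinear (cong λ i → V.act-∙ a b (v i))))
    ⋀ p = presentedRep (Alternating V.space p) (λ a → V.act a ∘_)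
      (λ { a (multilinear e)    → rel (multilinear (act-multilinear a e))
         ; a (repeated v i≢j e) → rel (repeated (V.act a ∘ v) i≢j (L.⟦⟧-cong a e)) })
      (λ e v   → rel (multilinear (cong λ i → V.act-cong e (v i))))
      (λ v     → rel (multilinear (cong λ i → V.act-ε (v i))))
      (λ a b v → rel (multilinear (cong λ i → V.act-∙ a b (v i))))

  infixr 7 _⊗_

  _⊗_ : Representation K G m ℓm → Representation K G n ℓn →
        Representation K G (c ⊔ m ⊔ n) (c ⊔ ℓ ⊔ m ⊔ ℓm ⊔ n ⊔ ℓn)
  V ⊗ W = presentedRep (Bilinear V.space W.space)
    (λ a (v , w) → V.act a v , W.act a w)
    resp
    (λ e (v , w)   → rel (cong (V.act-cong e v) (W.act-cong e w)))
    (λ (v , w)     → rel (cong (V.act-ε v) (W.act-ε w)))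
    (λ a b (v , w) → rel (cong (V.act-∙ a b v) (W.act-∙ a b w)))
    where
    module V = Representation V
    module W = Representation W
    module VS = Module V.space
    module WS = Module W.space
    resp : ∀ a {s t} → Bilinear V.space W.space s t →
           Generated K (Bilinear V.space W.space)
             (mapComb K (λ (v , w) → V.act a v , W.act a w) s)
             (mapComb K (λ (v , w) → V.act a v , W.act a w) t)
    resp a (cong e e′)     = rel (cong (V.act-linear.⟦⟧-cong a e) (W.act-linear.⟦⟧-cong a e′))
    resp a (addˡ v v′ w)   = ~-trans (rel (cong (V.act-linear.+ᴹ-homo a v v′) WS.≈ᴹ-refl)) (rel (addˡ _ _ _))
    resp a (addʳ v w w′)   = ~-trans (rel (cong VS.≈ᴹ-refl (W.act-linear.+ᴹ-homo a w w′))) (rel (addʳ _ _ _))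
    resp a (scaleˡ r v w)  = ~-trans (rel (cong (V.act-linear.*ₗ-homo a r v) WS.≈ᴹ-refl)) (rel (scaleˡ _ _ _))
    resp a (scaleʳ r v w)  = ~-trans (rel (cong VS.≈ᴹ-refl (W.act-linear.*ₗ-homo a r w))) (rel (scaleʳ _ _ _))

  -- The isotypic component of the trivial representation, as a submodule: equality ignores the
  -- proofs of invariance.
  Invariants : Representation K G m ℓm → Module K (g ⊔ m ⊔ ℓm) ℓm
  Invariants V = record
    { Carrierᴹ = Σ S.Carrierᴹ λ v → ∀ a → V.act a v S.≈ᴹ v
    ; _≈ᴹ_ = λ (v , _) (w , _) → v S.≈ᴹ w
    ; _+ᴹ_ = λ (v , v-inv) (w , w-inv) → v S.+ᴹ w ,
        λ a → S.≈ᴹ-trans (L.+ᴹ-homo a v w) (S.+ᴹ-cong (v-inv a) (w-inv a))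
    ; _*ₗ_ = λ r (v , v-inv) → r S.*ₗ v ,
        λ a → S.≈ᴹ-trans (L.*ₗ-homo a r v) (S.*ₗ-cong K.refl (v-inv a))
    ; _*ᵣ_ = λ (v , v-inv) r → v S.*ᵣ r ,
        λ a → S.≈ᴹ-trans (L.*ᵣ-homo a r v) (S.*ᵣ-cong (v-inv a) K.refl)
    ; 0ᴹ = S.0ᴹ , L.0ᴹ-homo
    ; -ᴹ_ = λ (v , v-inv) → S.-ᴹ v ,
        λ a → S.≈ᴹ-trans (L.-ᴹ-homo a v) (S.-ᴹ‿cong (v-inv a))
    ; isModule = record
      { isBimodule = record
        { isBisemimodule = record
          { +ᴹ-isCommutativeMonoid = record
            { isMonoid = record
              { isSemigroup = record
                { isMagma = record
                  { isEquivalence = record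
                    { refl = S.≈ᴹ-refl ; sym = S.≈ᴹ-sym ; trans = S.≈ᴹ-trans }
                  ; ∙-cong = S.+ᴹ-cong }
                ; assoc = λ (u , _) (v , _) (w , _) → S.+ᴹ-assoc u v w }
              ; identity = (λ (v , _) → S.+ᴹ-identityˡ v) , (λ (v , _) → S.+ᴹ-identityʳ v) }
            ; comm = λ (v , _) (w , _) → S.+ᴹ-comm v w }
          ; isPreleftSemimodule = record
            { *ₗ-cong = S.*ₗ-cong
            ; *ₗ-zeroˡ = λ (v , _) → S.*ₗ-zeroˡ v
            ; *ₗ-distribʳ = λ (v , _) → S.*ₗ-distribʳ v
            ; *ₗ-identityˡ = λ (v , _) → S.*ₗ-identityˡ v
            ; *ₗ-assoc = λ r s (v , _) → S.*ₗ-assoc r s v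
            ; *ₗ-zeroʳ = S.*ₗ-zeroʳ
            ; *ₗ-distribˡ = λ r (v , _) (w , _) → S.*ₗ-distribˡ r v w }
          ; isPrerightSemimodule = record
            { *ᵣ-cong = S.*ᵣ-cong
            ; *ᵣ-zeroʳ = λ (v , _) → S.*ᵣ-zeroʳ v
            ; *ᵣ-distribˡ = λ (v , _) → S.*ᵣ-distribˡ v
            ; *ᵣ-identityʳ = λ (v , _) → S.*ᵣ-identityʳ v
            ; *ᵣ-assoc = λ (v , _) → S.*ᵣ-assoc v
            ; *ᵣ-zeroˡ = S.*ᵣ-zeroˡ
            ; *ᵣ-distribʳ = λ r (v , _) (w , _) → S.*ᵣ-distribʳ r v w }
          ; *ₗ-*ᵣ-assoc = λ r (v , _) s → S.*ₗ-*ᵣ-assoc r v s }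
        ; -ᴹ‿cong = S.-ᴹ‿cong
        ; -ᴹ‿inverse = (λ (v , _) → S.-ᴹ‿inverseˡ v) , (λ (v , _) → S.-ᴹ‿inverseʳ v) }
      ; *ₗ-*ᵣ-coincident = λ r (v , _) → S.*ₗ-*ᵣ-coincident r v } }
    where
    module V = Representation V
    module S = Module V.space
    module L = V.act-linear

module _ (K : CommutativeRing c ℓ) (G : Group g ℓg) where
  private
    module G = Group G

  data SameElement : Rel (Comb K G.Carrier) (c ⊔ g ⊔ ℓg) where
    same : ∀ {a b} → a G.≈ b → SameElement (gen a) (gen b)

  -- The free module on G with basis elements e_b = gen b, and a · e_b = e_{ab}.
  regular : Representation K G (c ⊔ g) (c ⊔ ℓ ⊔ g ⊔ ℓg)
  regular = presentedRep SameElement G._∙_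
    (λ { a (same e) → rel (same (G.∙-congˡ e)) })
    (λ e b    → rel (same (G.∙-congʳ e)))
    (λ b      → rel (same (G.identityˡ b)))
    (λ a b d  → rel (same (G.assoc a b d)))

HasOrder : Group g ℓg → ℕ → Set (g ⊔ ℓg)
HasOrder G n = Inverse (≡.setoid (Fin n)) (Group.setoid G)

-- The division is exact.
multinomial : ℕ → ℕ → ℕ → ℕ
multinomial p q m = ((p ℕ.+ q ℕ.+ m) ℕ.!) / (p ℕ.! ℕ.* q ℕ.! ℕ.* m ℕ.!)
  where
  instance
    nonZero : NonZero (p ℕ.! ℕ.* q ℕ.! ℕ.* m ℕ.!)
    nonZero = ℕ.m*n≢0 (p ℕ.! ℕ.* q ℕ.!) (m ℕ.!) {{p ℕ.!* q !≢0}} {{m ℕ.!≢0}}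

{-# OPTIONS --safe #-}
module Submission where

-- Multisets of size p tensor subsets of size m index a basis of 𝒮ᵖ(R) ⊗ ⋀ᵐ(R) that G permutes up
-- to sign.  The action on indices is free: if a fixes a multiplicity function c : G → ℕ, then
-- substituting a x for x in P = ∏ x ^ c(x) gives P = a ^ (∑ c) P, so the order of a divides p, m and
-- |G| = q + m, hence divides gcd(p, q, m) = 1.  The signs therefore never obstruct: a suitable signed version
-- of the basis is permuted freely, the orbit sums form a basis of the invariants, and the dimension
-- is C(p + q + m - 1, p) C(q + m, m) / (q + m).  Neither inverses nor roots of unity in the
-- coefficient ring are needed.

open import Defs
open import Algebra.Bundles using (CommutativeRing; CommutativeMonoid; Group; AbelianGroup)
open import Algebra.Module.Bundles using (Module)
import Algebra.Properties.CommutativeMonoid.Mult as Mult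
import Algebra.Properties.CommutativeMonoid.Sum as CommutativeMonoidSum
import Algebra.Properties.CommutativeSemigroup as CommutativeSemigroupProperties
import Algebra.Properties.Group as GroupProperties
import Algebra.Properties.Monoid.Sum as MonoidSum
import Algebra.Properties.Ring as RingProperties
import Algebra.Properties.Semiring.Sum as SemiringSum
import Algebra.Solver.Ring.NaturalCoefficients.Default as NaturalSolver
open import Data.Fin.Base using (Fin; zero; suc; punchIn)
open import Data.Fin.Permutation as Perm
  using (Permutation; Permutation′; permutation; _⟨$⟩ʳ_; _⟨$⟩ˡ_; ↔⇒≡)
import Data.Fin.Properties as Fin
open import Data.Nat.Base as ℕ using (ℕ; zero; suc; _+_; _*_; _!; NonZero; _∸_)
open import Data.Nat.Combinatorics
  using (_C_; nCk≡n!/k![n-k]!; k![n∸k]!∣n!; nCk+nC[k+1]≡[n+1]C[k+1]; nCn≡1)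
open import Data.Nat.DivMod using (m/n*n≡m; m*n/n≡m; /-congˡ; /-congʳ)
open import Data.Nat.GCD using (gcd; gcd-comm; gcd-GCD; module Bézout)
open import Data.Nat.GeneralisedArithmetic using (fold)
import Data.Nat.Properties as ℕ
open import Data.Nat.Solver using (module +-*-Solver)
open import Data.Product as Product using (∃; ∃₂; _×_; _,_; proj₁; proj₂)
open import Data.Product.Function.NonDependent.Propositional using (_×-↔_)
import Data.Product.Properties as ×
import Data.Rational.Base as ℚ
import Data.Rational.Properties as ℚ
open import Data.Sum.Base using (_⊎_; inj₁; inj₂)
open import Data.Sum.Function.Propositional using (_⊎-↔_)
open import Data.Vec.Base as Vec using (Vec; []; _∷_; updateAt; lookup)
open import Data.Vec.Functional as F using (Vector)
import Data.Vec.Properties as Vec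
open import Function.Base using (_∘_)
open import Function.Bundles using (Inverse; _↔_; mk↔ₛ′; mk⤖)
open import Function.Construct.Composition using (_↔-∘_)
open import Function.Construct.Symmetry using (↔-sym)
open import Function.Properties.Bijection using (⤖⇒↔)
open import Function.Properties.Inverse using (Inverse⇒Injection)
open import Level using (Level; _⊔_)
open import Relation.Binary.Core using (Rel)
open import Relation.Binary.Definitions using (Decidable; Reflexive; Transitive)
open import Relation.Binary.PropositionalEquality as ≡ using (_≡_; _≢_)
open import Relation.Nullary using (¬_; Dec; yes; no; contradiction)
open import Relation.Nullary.Decidable using (from-no)

-- Formal combinations are compared by a generated congruence, which cannot be refuted by inspecting
-- expressions, so independence of the monomials rests on explicit coordinate functionals. A
-- generator of a power is sent to the coefficients of a product of linear forms, one for each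
-- entry, in commuting variables for the symmetric power and in anticommuting ones for the exterior
-- power. `Kind` lets both powers share one index type, one sorting procedure and one
-- multiplication. The sign of a permuted monomial is never computed: sorting a product returns some
-- `s` with `s * s` equal to 1 together with an index. The multiplicities determine that index, so
-- the laws of the action on indices are equalities of multiplicities. A sign could spoil an orbit
-- sum only if one index were reached twice with different signs, which freeness excludes. The two
-- dimensions are compared through `d * (p + q + m) ≡ multinomial p q m`: the right side is
-- symmetric in `p` and `q`, and the equation determines `d` because `p + q + m` is nonzero.

private
  variable
    c ℓ g ℓg m ℓm m′ ℓm′ i j x ρ : Level

-- Bases

module _ {K : CommutativeRing c ℓ} (M : Module K m ℓm) where
  private
    module K = CommutativeRing K
  open Module M

  -- Inductive instead of finite sums, so that linear statements are proved by recursion on the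
  -- derivation and the basis may be indexed by any type.
  data Span {I : Set i} (b : I → Carrierᴹ) : Carrierᴹ → Set (c ⊔ m ⊔ ℓm ⊔ i) where
    base  : ∀ k → Span b (b k)
    zero  : Span b 0ᴹ
    plus  : ∀ {u v} → Span b u → Span b v → Span b (u +ᴹ v)
    scale : ∀ r {v} → Span b v → Span b (r *ₗ v)
    resp  : ∀ {u v} → u ≈ᴹ v → Span b u → Span b v

  Span-mono : {I : Set i} {J : Set j} {b : I → Carrierᴹ} {b′ : J → Carrierᴹ} →
              (∀ k → Span b′ (b k)) → ∀ {v} → Span b v → Span b′ v
  Span-mono f (base k)    = f k
  Span-mono f zero        = zero
  Span-mono f (plus s t)  = plus (Span-mono f s) (Span-mono f t)
  Span-mono f (scale r s) = scale r (Span-mono f s)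
  Span-mono f (resp e s)  = resp e (Span-mono f s)

  -- A basis given with its dual basis of coordinate functionals, which makes independence
  -- automatic and needs no finiteness of the index set.
  record DualBasis {I : Set i} (b : I → Carrierᴹ) : Set (c ⊔ ℓ ⊔ m ⊔ ℓm ⊔ i) where
    field
      coord      : Carrierᴹ → I → K.Carrier
      coord-cong : ∀ {u v} → u ≈ᴹ v → ∀ k → coord u k K.≈ coord v k
      coord-0    : ∀ k → coord 0ᴹ k K.≈ K.0#
      coord-+    : ∀ u v k → coord (u +ᴹ v) k K.≈ coord u k K.+ coord v k
      coord-*    : ∀ r v k → coord (r *ₗ v) k K.≈ r K.* coord v k
      coord-same : ∀ k → coord (b k) k K.≈ K.1#
      coord-diff : ∀ {k l} → k ≢ l → coord (b k) l K.≈ K.0#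
      spanning   : ∀ v → Span b v

  -- The case s = ±1 covers bases that are permuted up to sign.
  rebase : {I : Set i} {J : Set j} {b : I → Carrierᴹ} → DualBasis b →
           (b′ : J → Carrierᴹ) (f : J → I) (s : J → K.Carrier) →
           (∀ {k l} → f k ≡ f l → k ≡ l) → (∀ k → ∃ λ l → f l ≡ k) →
           (∀ k → s k K.* s k K.≈ K.1#) →
           (∀ k → b′ k ≈ᴹ s k *ₗ b (f k)) → DualBasis b′
  rebase {b = b} B b′ f s f-inj f-surj s²≈1 b′≈ = record
    -- Since `s k` is its own inverse, multiplying by it turns the coefficient of `b (f k)` into
    -- that of `b′ k`.
    { coord      = λ v k → s k K.* coord v (f k)
    ; coord-cong = λ e k → K.*-congˡ (coord-cong e (f k))
    ; coord-0    = λ k → K.trans (K.*-congˡ (coord-0 (f k))) (K.zeroʳ _)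
    ; coord-+    = λ u v k → K.trans (K.*-congˡ (coord-+ u v (f k))) (K.distribˡ _ _ _)
    ; coord-*    = λ r v k → K.trans (K.*-congˡ (coord-* r v (f k)))
        (K.trans (K.sym (K.*-assoc _ _ _)) (K.trans (K.*-congʳ (K.*-comm _ _)) (K.*-assoc _ _ _)))
    ; coord-same = λ k → K.trans (K.*-congˡ (b′-coord k (f k)))
        (K.trans (K.sym (K.*-assoc _ _ _))
          (K.trans (K.*-cong (s²≈1 k) (coord-same (f k))) (K.*-identityˡ _)))
    ; coord-diff = λ {k} {l} k≢l → K.trans (K.*-congˡ (b′-coord k (f l)))
        (K.trans (K.*-congˡ (K.trans (K.*-congˡ (coord-diff (k≢l ∘ f-inj))) (K.zeroʳ _))) (K.zeroʳ _))
    ; spanning   = λ v → Span-mono b-span (spanning v)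
    }
    where
    open DualBasis B
    b′-coord : ∀ k l → coord (b′ k) l K.≈ s k K.* coord (b (f k)) l
    b′-coord k l = K.trans (coord-cong (b′≈ k) l) (coord-* _ _ l)
    b-span : ∀ k → Span b′ (b k)
    b-span k with l , ≡.refl ← f-surj k = resp
      (≈ᴹ-trans (*ₗ-cong K.refl (b′≈ l)) (≈ᴹ-trans (≈ᴹ-sym (*ₗ-assoc _ _ _))
        (≈ᴹ-trans (*ₗ-cong (s²≈1 l) ≈ᴹ-refl) (*ₗ-identityˡ _))))
      (scale (s l) (base l))

-- Dual bases of presented modules, tensor products and the regular representation

module _ (K : CommutativeRing c ℓ) where
  private
    module K = CommutativeRing K

  extend : {X : Set x} → (X → K.Carrier) → Comb K X → K.Carrier
  extend f (gen y) = f y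
  extend f 𝟘       = K.0#
  extend f (s ⊕ t) = extend f s K.+ extend f t
  extend f (r ⊙ s) = r K.* extend f s

  -- `K` is itself a module, so every axiom holds after evaluation and only the relations in `Q`
  -- remain to be checked.
  extend-cong : {X : Set x} {Q : Rel (Comb K X) ρ} (f : X → K.Carrier) →
                (∀ {s t} → Q s t → extend f s K.≈ extend f t) →
                ∀ {s t} → Generated K Q s t → extend f s K.≈ extend f t
  extend-cong f h (rel e)            = h e
  extend-cong f h ~-refl             = K.refl
  extend-cong f h (~-sym e)          = K.sym (extend-cong f h e)
  extend-cong f h (~-trans e e′)     = K.trans (extend-cong f h e) (extend-cong f h e′)
  extend-cong f h (⊕-cong e e′)      = K.+-cong (extend-cong f h e) (extend-cong f h e′)
  extend-cong f h (⊙-cong r e)       = K.*-cong r (extend-cong f h e)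
  extend-cong f h (⊕-assoc _ _ _)    = K.+-assoc _ _ _
  extend-cong f h (⊕-comm _ _)       = K.+-comm _ _
  extend-cong f h (⊕-identityˡ _)    = K.+-identityˡ _
  extend-cong f h (⊙-distribˡ _ _ _) = K.distribˡ _ _ _
  extend-cong f h (⊙-distribʳ _ _ _) = K.distribʳ _ _ _
  extend-cong f h (⊙-assoc _ _ _)    = K.*-assoc _ _ _
  extend-cong f h (⊙-identity _)     = K.*-identityˡ _
  extend-cong f h (⊙-zeroˡ _)        = K.zeroˡ _
  extend-cong f h (⊙-zeroʳ _)        = K.zeroʳ _

  module _ {X : Set x} {Q : Rel (Comb K X) ρ} {I : Set i} {b : I → Comb K X} where

    presentedSpanning : (∀ y → Span (Presented K Q) b (gen y)) → ∀ v → Span (Presented K Q) b v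
    presentedSpanning h (gen y) = h y
    presentedSpanning h 𝟘       = zero
    presentedSpanning h (s ⊕ t) = plus (presentedSpanning h s) (presentedSpanning h t)
    presentedSpanning h (r ⊙ s) = scale r (presentedSpanning h s)

    -- The common source of the bases of the regular representation, the powers and the tensor
    -- product: coordinates obtained by `extend` are linear by definition, and spanning reduces to
    -- generators.
    presentedDualBasis : (f : X → I → K.Carrier) →
      (∀ k {s t} → Q s t → extend (λ y → f y k) s K.≈ extend (λ y → f y k) t) →
      (∀ k → extend (λ y → f y k) (b k) K.≈ K.1#) →
      (∀ {k l} → k ≢ l → extend (λ y → f y l) (b k) K.≈ K.0#) →
      (∀ y → Span (Presented K Q) b (gen y)) →
      DualBasis (Presented K Q) b
    presentedDualBasis f h diag off span = record
      { coord      = λ s k → extend (λ y → f y k) s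
      ; coord-cong = λ e k → extend-cong (λ y → f y k) (h k) e
      ; coord-0    = λ _ → K.refl
      ; coord-+    = λ _ _ _ → K.refl
      ; coord-*    = λ _ _ _ → K.refl
      ; coord-same = diag
      ; coord-diff = off
      ; spanning   = presentedSpanning span
      }

module _ {K : CommutativeRing c ℓ} (V : Module K m ℓm) (W : Module K m′ ℓm′) where
  private
    module K = CommutativeRing K
    module V = Module V
    module W = Module W

  tensorDualBasis : {I : Set i} {J : Set j} {b : I → V.Carrierᴹ} {b′ : J → W.Carrierᴹ} →
    (∀ (k l : I) → Dec (k ≡ l)) →
    DualBasis V b → DualBasis W b′ →
    DualBasis (Tensor V W) (λ ((k , l) : I × J) → gen (b k , b′ l))
  tensorDualBasis {I = I} {J = J} {b = b} {b′ = b′} _≟_ B B′ = presentedDualBasis K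
    (λ (v , w) (k , l) → B.coord v k K.* B′.coord w l)
    (λ { _ (cong e e′)    → K.*-cong (B.coord-cong e _) (B′.coord-cong e′ _)
       ; _ (addˡ _ _ _)   → K.trans (K.*-congʳ (B.coord-+ _ _ _)) (K.distribʳ _ _ _)
       ; _ (addʳ _ _ _)   → K.trans (K.*-congˡ (B′.coord-+ _ _ _)) (K.distribˡ _ _ _)
       ; _ (scaleˡ _ _ _) → K.trans (K.*-congʳ (B.coord-* _ _ _)) (K.*-assoc _ _ _)
       ; _ (scaleʳ r v w) → K.trans (K.*-congˡ (B′.coord-* _ _ _))
           (K.trans (K.sym (K.*-assoc _ _ _)) (K.trans (K.*-congʳ (K.*-comm _ _)) (K.*-assoc _ _ _))) })
    (λ (k , l) → K.trans (K.*-cong (B.coord-same k) (B′.coord-same l)) (K.*-identityˡ _))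
    diff
    (λ (v , w) → spanˡ (B.spanning v) (B′.spanning w))
    where
    module B = DualBasis B
    module B′ = DualBasis B′

    bb′ : I × J → Comb K (V.Carrierᴹ × W.Carrierᴹ)
    bb′ (k , l) = gen (b k , b′ l)

    diff : ∀ {kl kl′ : I × J} → kl ≢ kl′ →
      B.coord (b (proj₁ kl)) (proj₁ kl′) K.* B′.coord (b′ (proj₂ kl)) (proj₂ kl′) K.≈ K.0#
    -- Decidability tells which factor of the product of coordinates vanishes.
    diff {k , l} {k′ , l′} ne with k ≟ k′
    ... | no k≢k′    = K.trans (K.*-congʳ (B.coord-diff k≢k′)) (K.zeroˡ _)
    ... | yes ≡.refl = K.trans (K.*-congˡ (B′.coord-diff (ne ∘ ≡.cong (k ,_)))) (K.zeroʳ _)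

    spanʳ : ∀ k {w} → Span W b′ w → Span (Tensor V W) bb′ (gen (b k , w))
    spanʳ k (base l)    = base (k , l)
    spanʳ k zero        = resp (~-sym (~-trans (rel (cong V.≈ᴹ-refl (W.≈ᴹ-sym (W.*ₗ-zeroˡ W.0ᴹ))))
                            (~-trans (rel (scaleʳ K.0# _ _)) (⊙-zeroˡ _)))) zero
    spanʳ k (plus s t)  = resp (~-sym (rel (addʳ _ _ _))) (plus (spanʳ k s) (spanʳ k t))
    spanʳ k (scale r s) = resp (~-sym (rel (scaleʳ _ _ _))) (scale r (spanʳ k s))
    spanʳ k (resp e s)  = resp (rel (cong V.≈ᴹ-refl e)) (spanʳ k s)

    spanˡ : ∀ {v w} → Span V b v → Span W b′ w → Span (Tensor V W) bb′ (gen (v , w))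
    spanˡ (base k)    t = spanʳ k t
    spanˡ zero        t = resp (~-sym (~-trans (rel (cong (V.≈ᴹ-sym (V.*ₗ-zeroˡ V.0ᴹ)) W.≈ᴹ-refl))
                            (~-trans (rel (scaleˡ K.0# _ _)) (⊙-zeroˡ _)))) zero
    spanˡ (plus s s′) t = resp (~-sym (rel (addˡ _ _ _))) (plus (spanˡ s t) (spanˡ s′ t))
    spanˡ (scale r s) t = resp (~-sym (rel (scaleˡ _ _ _))) (scale r (spanˡ s t))
    spanˡ (resp e s)  t = resp (rel (cong e W.≈ᴹ-refl)) (spanˡ s t)

module _ (K : CommutativeRing c ℓ) where
  private
    module K = CommutativeRing K

  -- Recursive, so that shifted indices reduce.
  unit : ∀ {n} → Fin n → Fin n → K.Carrier
  unit zero    zero    = K.1#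
  unit zero    (suc _) = K.0#
  unit (suc _) zero    = K.0#
  unit (suc k) (suc l) = unit k l

  unit-same : ∀ {n} (k : Fin n) → unit k k ≡ K.1#
  unit-same zero    = ≡.refl
  unit-same (suc k) = unit-same k

  unit-diff : ∀ {n} {k l : Fin n} → k ≢ l → unit k l ≡ K.0#
  unit-diff {k = zero}  {zero}  k≢l = contradiction ≡.refl k≢l
  unit-diff {k = zero}  {suc _} _   = ≡.refl
  unit-diff {k = suc _} {zero}  _   = ≡.refl
  unit-diff {k = suc k} {suc l} k≢l = unit-diff (k≢l ∘ ≡.cong suc)

  regularDualBasis : (G : Group g ℓg) {n : _} (order : HasOrder G n) →
    DualBasis (Representation.space (regular K G)) (λ k → gen (Inverse.to order k))
  regularDualBasis G order = presentedDualBasis K (λ a k → unit (from a) k)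
    (λ { k (same e) → K.reflexive (≡.cong (λ l → unit l k) (from-cong e)) })
    (λ k → K.reflexive (≡.trans (≡.cong (λ l → unit l k) (strictlyInverseʳ k)) (unit-same k)))
    (λ {k} {l} k≢l → K.reflexive
      (≡.trans (≡.cong (λ k′ → unit k′ l) (strictlyInverseʳ k)) (unit-diff k≢l)))
    (λ a → resp (rel (same (strictlyInverseˡ a))) (base (from a)))
    where open Inverse order

-- Orbit sums

module _ (M : CommutativeMonoid m ℓm) where
  open CommutativeMonoid M
  open CommutativeMonoidSum M using (sum; sum-cong-≋; sum-replicate-zero)

  sum-0 : ∀ {n} {f : Fin n → Carrier} → (∀ k → f k ≈ ε) → sum f ≈ ε
  sum-0 {n} f≈0 = trans (sum-cong-≋ {n} f≈0) (sum-replicate-zero n)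

  sum-single : ∀ {n} (f : Fin n → Carrier) k → (∀ l → k ≢ l → f l ≈ ε) → sum f ≈ f k
  sum-single f zero    h = trans (∙-congˡ (sum-0 λ l → h (suc l) λ ())) (identityʳ _)
  sum-single f (suc k) h = trans (∙-cong (h zero λ ())
    (sum-single (f ∘ suc) k λ l k≢l → h (suc l) (k≢l ∘ Fin.suc-injective))) (identityˡ _)

module _ (G : Group g ℓg) {n : ℕ} (order : HasOrder G n) where
  open Group G
  open Inverse order using (to; from; from-cong; strictlyInverseˡ; strictlyInverseʳ)

  translate : Carrier → Fin n → Fin n
  translate a k = from (a ∙ to k)

  to-translate : ∀ a k → to (translate a k) ≈ a ∙ to k
  to-translate a k = strictlyInverseˡ (a ∙ to k)

  translate-cancel : ∀ a b → a ∙ b ≈ ε → ∀ k → translate a (translate b k) ≡ k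
  translate-cancel a b ab≈ε k = ≡.trans
    (from-cong (trans (∙-congˡ (to-translate b k))
      (trans (sym (assoc a b (to k))) (trans (∙-congʳ ab≈ε) (identityˡ _)))))
    (strictlyInverseʳ k)

  translation : Carrier → Permutation′ n
  translation a = permutation (translate a) (translate (a ⁻¹))
    (translate-cancel a (a ⁻¹) (inverseʳ a)) (translate-cancel (a ⁻¹) a (inverseˡ a))

module _ {K : CommutativeRing c ℓ} {G : Group g ℓg} {n : ℕ} (order : HasOrder G n)
         (V : Representation K G m ℓm) {d : ℕ} (u : Fin d → Module.Carrierᴹ (Representation.space V))
  where
  private
    module K = CommutativeRing K
    module G = Group G
    module V = Representation V
    module L = V.act-linear
    module I = Module (Invariants V)
    module ΣK = SemiringSum K.semiring
    open Module V.space
    module ΣV = CommutativeMonoidSum +ᴹ-commutativeMonoid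
    module ΣI = MonoidSum I.+ᴹ-monoid
    open Inverse order using (to; from; from-cong)
    open import Relation.Binary.Reasoning.Setoid ≈ᴹ-setoid

    -- Translates of the orbit representatives `u o`; the action moves only the second index, by
    -- `translate`.
    b : Fin d × Fin n → Carrierᴹ
    b (o , k) = V.act (to k) (u o)

    lincomb : (Fin d → Fin n → K.Carrier) → Carrierᴹ
    lincomb r = ΣV.sum λ o → ΣV.sum λ k → r o k *ₗ b (o , k)

    *ₗ-sum : ∀ r {N} (f : Fin N → Carrierᴹ) → r *ₗ ΣV.sum f ≈ᴹ ΣV.sum (λ k → r *ₗ f k)
    *ₗ-sum r {zero}  f = *ₗ-zeroʳ r
    *ₗ-sum r {suc N} f = ≈ᴹ-trans (*ₗ-distribˡ r _ _) (+ᴹ-cong ≈ᴹ-refl (*ₗ-sum r (f ∘ suc)))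

    act-sum : ∀ a {N} (f : Fin N → Carrierᴹ) → V.act a (ΣV.sum f) ≈ᴹ ΣV.sum (V.act a ∘ f)
    act-sum a {zero}  f = L.0ᴹ-homo a
    act-sum a {suc N} f = ≈ᴹ-trans (L.+ᴹ-homo a _ _) (+ᴹ-cong ≈ᴹ-refl (act-sum a (f ∘ suc)))

    proj₁-sum : ∀ {N} (f : Fin N → I.Carrierᴹ) → proj₁ (ΣI.sum f) ≡ ΣV.sum (proj₁ ∘ f)
    proj₁-sum {zero}  f = ≡.refl
    proj₁-sum {suc N} f = ≡.cong (proj₁ (f zero) +ᴹ_) (proj₁-sum (f ∘ suc))

    act-b : ∀ a o k → V.act a (b (o , k)) ≈ᴹ b (o , translate G order a k)
    act-b a o k = ≈ᴹ-trans (≈ᴹ-sym (V.act-∙ a (to k) (u o)))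
      (V.act-cong (G.sym (to-translate G order a k)) (u o))

    -- Translation by `a` is a permutation of the group, so acting merely reorders the summands.
    orbitSum : Fin d → I.Carrierᴹ
    orbitSum o = ΣV.sum (λ k → b (o , k)) , λ a → begin
      V.act a (ΣV.sum (λ k → b (o , k)))                ≈⟨ act-sum a {n} _ ⟩
      ΣV.sum (λ k → V.act a (b (o , k)))                ≈⟨ ΣV.sum-cong-≋ {n} (act-b a o) ⟩
      ΣV.sum (λ k → b (o , translate G order a k))      ≈⟨ ΣV.sum-permute _ (translation G order a) ⟨
      ΣV.sum (λ k → b (o , k))                          ∎

    lincomb-orbitSum : ∀ (r : Fin d → K.Carrier) → proj₁ (ΣI.sum (λ o → r o I.*ₗ orbitSum o)) ≈ᴹ lincomb (λ o _ → r o)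
    lincomb-orbitSum r = ≈ᴹ-trans (≈ᴹ-reflexive (proj₁-sum {d} λ o → r o I.*ₗ orbitSum o))
      (ΣV.sum-cong-≋ {d} λ o → *ₗ-sum (r o) {n} _)

  module _ (B : DualBasis V.space b) where
    private
      open DualBasis B

      coord-sum : ∀ {N} (f : Fin N → Carrierᴹ) k → coord (ΣV.sum f) k K.≈ ΣK.sum (λ l → coord (f l) k)
      coord-sum {zero}  f k = coord-0 k
      coord-sum {suc N} f k = K.trans (coord-+ _ _ k) (K.+-congˡ (coord-sum (f ∘ suc) k))

      coord-lincomb : ∀ r o k → coord (lincomb r) (o , k) K.≈ r o k
      coord-lincomb r o k = K.trans (coord-sum {d} _ _) (K.trans
        (sum-single K.+-commutativeMonoid {d} _ o λ o′ o≢o′ →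
          K.trans (coord-sum {n} _ _) (sum-0 K.+-commutativeMonoid {n} λ k′ →
            K.trans (coord-* _ _ _) (K.trans (K.*-congˡ (coord-diff (o≢o′ ∘ ≡.sym ∘ ×.,-injectiveˡ))) (K.zeroʳ _))))
        (K.trans (coord-sum {n} _ _) (K.trans
          (sum-single K.+-commutativeMonoid {n} _ k λ k′ k≢k′ →
            K.trans (coord-* _ _ _) (K.trans (K.*-congˡ (coord-diff (k≢k′ ∘ ≡.sym ∘ ×.,-injectiveʳ))) (K.zeroʳ _)))
          (K.trans (coord-* _ _ _) (K.trans (K.*-congˡ (coord-same _)) (K.*-identityʳ _))))))

      lincomb-cong : ∀ {r s} → (∀ o k → r o k K.≈ s o k) → lincomb r ≈ᴹ lincomb s
      lincomb-cong h = ΣV.sum-cong-≋ {d} λ o → ΣV.sum-cong-≋ {n} λ k → *ₗ-cong (h o k) ≈ᴹ-refl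

      -- Linearity of the coordinates carries the recursion; this is the passage from an inductive
      -- span to a finite sum.
      expand : ∀ {v} → Span V.space b v → v ≈ᴹ lincomb (λ o k → coord v (o , k))
      expand (base (o , k)) = ≈ᴹ-sym (≈ᴹ-trans
        (sum-single +ᴹ-commutativeMonoid {d} _ o λ o′ o≢o′ →
          sum-0 +ᴹ-commutativeMonoid {n} λ k′ →
            ≈ᴹ-trans (*ₗ-cong (coord-diff (o≢o′ ∘ ×.,-injectiveˡ)) ≈ᴹ-refl) (*ₗ-zeroˡ _))
        (≈ᴹ-trans (sum-single +ᴹ-commutativeMonoid {n} _ k λ k′ k≢k′ →
            ≈ᴹ-trans (*ₗ-cong (coord-diff (k≢k′ ∘ ×.,-injectiveʳ)) ≈ᴹ-refl) (*ₗ-zeroˡ _))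
          (≈ᴹ-trans (*ₗ-cong (coord-same _) ≈ᴹ-refl) (*ₗ-identityˡ _))))
      expand zero = ≈ᴹ-sym (sum-0 +ᴹ-commutativeMonoid {d} λ o → sum-0 +ᴹ-commutativeMonoid {n} λ k →
        ≈ᴹ-trans (*ₗ-cong (coord-0 _) ≈ᴹ-refl) (*ₗ-zeroˡ _))
      expand (plus {v} {w} s t) = begin
        v +ᴹ w
          ≈⟨ +ᴹ-cong (expand s) (expand t) ⟩
        lincomb (λ o k → coord v (o , k)) +ᴹ lincomb (λ o k → coord w (o , k))
          ≈⟨ ΣV.∑-distrib-+ {d} _ _ ⟨
        ΣV.sum (λ o → ΣV.sum (λ k → coord v (o , k) *ₗ b (o , k)) +ᴹ
                      ΣV.sum (λ k → coord w (o , k) *ₗ b (o , k)))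
          ≈⟨ ΣV.sum-cong-≋ {d} (λ o → ΣV.∑-distrib-+ {n} _ _) ⟨
        ΣV.sum (λ o → ΣV.sum λ k → coord v (o , k) *ₗ b (o , k) +ᴹ coord w (o , k) *ₗ b (o , k))
          ≈⟨ (ΣV.sum-cong-≋ {d} λ o → ΣV.sum-cong-≋ {n} λ k →
               ≈ᴹ-trans (*ₗ-cong (coord-+ _ _ _) ≈ᴹ-refl) (*ₗ-distribʳ _ _ _)) ⟨
        lincomb (λ o k → coord (v +ᴹ w) (o , k)) ∎
      expand (scale r {v} s) = begin
        r *ₗ v
          ≈⟨ *ₗ-cong K.refl (expand s) ⟩
        r *ₗ lincomb (λ o k → coord v (o , k))
          ≈⟨ ≈ᴹ-trans (*ₗ-sum r {d} _) (ΣV.sum-cong-≋ {d} λ o → *ₗ-sum r {n} _) ⟩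
        ΣV.sum (λ o → ΣV.sum λ k → r *ₗ coord v (o , k) *ₗ b (o , k))
          ≈⟨ (ΣV.sum-cong-≋ {d} λ o → ΣV.sum-cong-≋ {n} λ k →
               ≈ᴹ-trans (*ₗ-cong (coord-* _ _ _) ≈ᴹ-refl) (*ₗ-assoc _ _ _)) ⟨
        lincomb (λ o k → coord (r *ₗ v) (o , k)) ∎
      expand (resp e s) = ≈ᴹ-trans (≈ᴹ-sym e)
        (≈ᴹ-trans (expand s) (lincomb-cong λ o k → coord-cong e (o , k)))

      -- By linearity only basis vectors matter, and there translation by `a` is injective on the
      -- second index, so equal and distinct indices stay so.
      coord-act : ∀ a {v} → Span V.space b v →
                  ∀ o k → coord (V.act a v) (o , translate G order a k) K.≈ coord v (o , k)
      coord-act a (base (o′ , k′)) o k =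
        K.trans (coord-cong (act-b a o′ k′) _) (shift (×.≡-dec Fin._≟_ Fin._≟_ (o′ , k′) (o , k)))
        where
        undo : ∀ k → translate G order (a G.⁻¹) (translate G order a k) ≡ k
        undo = translate-cancel G order (a G.⁻¹) a (G.inverseˡ a)
        shift : Dec ((o′ , k′) ≡ (o , k)) → coord (b (o′ , translate G order a k′))
                  (o , translate G order a k) K.≈ coord (b (o′ , k′)) (o , k)
        shift (yes ≡.refl) = K.trans (coord-same _) (K.sym (coord-same _))
        shift (no ne) = K.trans
          (coord-diff λ e → ne (≡.cong₂ _,_ (×.,-injectiveˡ e)
            (≡.trans (≡.sym (undo k′))
              (≡.trans (≡.cong (translate G order (a G.⁻¹)) (×.,-injectiveʳ e)) (undo k)))))
          (K.sym (coord-diff ne))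
      coord-act a zero o k = K.trans (coord-cong (L.0ᴹ-homo a) _) (K.trans (coord-0 _) (K.sym (coord-0 _)))
      coord-act a (plus s t) o k = K.trans (coord-cong (L.+ᴹ-homo a _ _) _) (K.trans (coord-+ _ _ _)
        (K.trans (K.+-cong (coord-act a s o k) (coord-act a t o k)) (K.sym (coord-+ _ _ _))))
      coord-act a (scale r s) o k = K.trans (coord-cong (L.*ₗ-homo a r _) _) (K.trans (coord-* _ _ _)
        (K.trans (K.*-congˡ (coord-act a s o k)) (K.sym (coord-* _ _ _))))
      coord-act a (resp e s) o k = K.trans (coord-cong (L.⟦⟧-cong a (≈ᴹ-sym e)) _)
        (K.trans (coord-act a s o k) (coord-cong e _))

      k₀ : Fin n
      k₀ = from G.ε

      -- The inverse of `to k` carries the index `k` to `k₀`, the index of the identity, while it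
      -- leaves `v` fixed.
      coord-invariant : ∀ {v} → (∀ a → V.act a v ≈ᴹ v) → ∀ o k → coord v (o , k) K.≈ coord v (o , k₀)
      coord-invariant {v} v-inv o k = K.trans (K.sym (coord-act a (spanning v) o k))
        (K.trans (coord-cong (v-inv a) _)
          (K.reflexive (≡.cong (λ l → coord v (o , l)) (from-cong (G.inverseˡ (to k))))))
        where a = to k G.⁻¹

    -- Coordinates of an invariant vector are constant along each orbit, so the coefficient of an
    -- orbit sum is read off at the identity. No averaging over the group occurs.
    invariants-dimension : HasDimension (Invariants V) d
    invariants-dimension = orbitSum , record
      { independent = λ r e o → K.trans (K.sym (coord-lincomb (λ o _ → r o) o k₀))
          (K.trans (coord-cong (≈ᴹ-trans (≈ᴹ-sym (lincomb-orbitSum r)) e) _) (coord-0 _))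
      ; spanning = λ (v , v-inv) → (λ o → coord v (o , k₀)) ,
          ≈ᴹ-trans (expand (spanning v))
            (≈ᴹ-trans (lincomb-cong (coord-invariant v-inv))
              (≈ᴹ-sym (lincomb-orbitSum _)))
      }

-- Monomials in symmetric and exterior powers

data Kind : Set where
  sym ext : Kind

-- How many of `suc n` labels stay available once the least has been used: a multiset may use it
-- again, a subset may not.
next : Kind → ℕ → ℕ
next sym n = suc n
next ext n = n

-- Multisets (sym) or subsets (ext) of size p in an n-element set, as weakly or strictly
-- increasing sequences: take uses the least label, skip discards it.
data Idx (k : Kind) : ℕ → ℕ → Set where
  []   : Idx k 0 0
  skip : ∀ {n p} → Idx k n p → Idx k (suc n) p
  take : ∀ {n p} → Idx k (next k n) p → Idx k (suc n) (suc p)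

inc : ∀ {n} → Fin n → Vec ℕ n → Vec ℕ n
inc l c = updateAt c l suc

counts : ∀ {k n p} → Idx k n p → Vec ℕ n
counts             []       = []
counts             (skip M) = 0 ∷ counts M
counts {k = sym}   (take M) = inc zero (counts M)
counts {k = ext}   (take M) = 1 ∷ counts M

labels : ∀ {k n p} → Idx k n p → Vector (Fin n) p
labels           []       = λ ()
labels           (skip M) = suc ∘ labels M
labels {k = sym} (take M) = zero F.∷ labels M
labels {k = ext} (take M) = zero F.∷ suc ∘ labels M

empty : ∀ {k} n → Idx k n 0
empty zero    = []
empty (suc n) = skip (empty n)

counts-empty : ∀ {k} n → counts (empty {k} n) ≡ Vec.replicate n 0
counts-empty zero    = ≡.refl
counts-empty (suc n) = ≡.cong (0 ∷_) (counts-empty n)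

-- The direct image of a multiplicity function, written as iterated `inc` so that it follows
-- `relabel`, which inserts one label at a time.
push : ∀ {n n′} → (Fin n → Fin n′) → Vec ℕ n → Vec ℕ n′
push ι []      = Vec.replicate _ 0
push ι (a ∷ c) = fold (push (ι ∘ suc) c) (inc (ι zero)) a

push-inc : ∀ {n n′} (ι : Fin (suc n) → Fin n′) c → push ι (inc zero c) ≡ inc (ι zero) (push ι c)
push-inc ι (a ∷ c) = ≡.refl

module _ {K : CommutativeRing c ℓ} where
  private
    module K = CommutativeRing K
  open RingProperties K.ring using (-1*x≈-x; -‿involutive)

  sign : Kind → K.Carrier
  sign sym = K.1#
  sign ext = K.- K.1#

  sign² : ∀ k → sign k K.* sign k K.≈ K.1#
  sign² sym = K.*-identityˡ _
  sign² ext = K.trans (-1*x≈-x _) (-‿involutive _)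

module _ {K : CommutativeRing c ℓ} (V : Module K m ℓm) where
  private
    module K = CommutativeRing K
    module V = Module V

  PowerRel : Kind → ∀ p → Rel (Comb K (Vector V.Carrierᴹ p)) (c ⊔ m ⊔ ℓm)
  PowerRel sym = Symmetric V
  PowerRel ext = Alternating V

  Power : Kind → ℕ → Module K (c ⊔ m) (c ⊔ ℓ ⊔ m ⊔ ℓm)
  Power k p = Presented K (PowerRel k p)

  module _ (k : Kind) where
    private
      infix 4 _~_
      _~_ : ∀ {p} → Rel (Comb K (Vector V.Carrierᴹ p)) (c ⊔ ℓ ⊔ m ⊔ ℓm)
      _~_ {p} = Generated K (PowerRel k p)

    multi : ∀ {p s t} → Multilinear V p s t → s ~ t
    multi = rel ∘ multi′ k
      where
      multi′ : ∀ k {p s t} → Multilinear V p s t → PowerRel k p s t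
      multi′ sym = multilinear
      multi′ ext = multilinear

    gen-cong : ∀ {p} {v w : Vector V.Carrierᴹ p} → (∀ l → v l V.≈ᴹ w l) → gen v ~ gen w
    gen-cong e = multi (cong e)

    cons : V.Carrierᴹ → ∀ {p} → Comb K (Vector V.Carrierᴹ p) → Comb K (Vector V.Carrierᴹ (suc p))
    cons v = mapComb K (v F.∷_)

    private
      cons-multilinear : ∀ v {p s t} → Multilinear V p s t → Multilinear V (suc p) (cons v s) (cons v t)
      cons-multilinear v (cong e)           = cong λ { zero → V.≈ᴹ-refl ; (suc l) → e l }
      cons-multilinear v (add l e e′ e″)    = add (suc l) e
        (λ { zero _ → V.≈ᴹ-refl ; (suc l′) ne → e′ l′ (ne ∘ ≡.cong suc) })
        (λ { zero _ → V.≈ᴹ-refl ; (suc l′) ne → e″ l′ (ne ∘ ≡.cong suc) })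
      cons-multilinear v (scale l r e e′)   = scale (suc l) r e
        (λ { zero _ → V.≈ᴹ-refl ; (suc l′) ne → e′ l′ (ne ∘ ≡.cong suc) })

      cons-rel : ∀ k v {p s t} → PowerRel k p s t → Generated K (PowerRel k (suc p)) (cons v s) (cons v t)
      cons-rel sym v (multilinear e)    = rel (multilinear (cons-multilinear v e))
      cons-rel sym v (permute π w)      = ~-trans
        (rel (multilinear (cong λ { zero → V.≈ᴹ-refl ; (suc l) → V.≈ᴹ-refl })))
        (rel (permute (Perm.lift₀ π) (v F.∷ w)))
      cons-rel ext v (multilinear e)    = rel (multilinear (cons-multilinear v e))
      cons-rel ext v (repeated w i≢j e) = rel (repeated (v F.∷ w) (i≢j ∘ Fin.suc-injective) e)

    -- Makes multiplication by `v` on the left a linear map of powers; rewriting behind a fixed head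
    -- goes through it.
    cons-cong : ∀ v {p} {s t : Comb K (Vector V.Carrierᴹ p)} → s ~ t → cons v s ~ cons v t
    cons-cong v = mapComb-cong K (v F.∷_) (cons-rel k v)

    gen-head∷tail : ∀ {p} (v : Vector V.Carrierᴹ (suc p)) → gen v ~ gen (v zero F.∷ v ∘ suc)
    gen-head∷tail v = gen-cong λ { zero → V.≈ᴹ-refl ; (suc l) → V.≈ᴹ-refl }

    cong-head : ∀ {u v p} {w : Vector V.Carrierᴹ p} → u V.≈ᴹ v → gen (u F.∷ w) ~ gen (v F.∷ w)
    cong-head e = gen-cong λ { zero → e ; (suc l) → V.≈ᴹ-refl }

    add-head : ∀ u v {p} {w : Vector V.Carrierᴹ p} →
               gen (u V.+ᴹ v F.∷ w) ~ gen (u F.∷ w) ⊕ gen (v F.∷ w)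
    add-head u v = multi (add zero V.≈ᴹ-refl (λ { zero ne → contradiction ≡.refl ne ; (suc _) _ → V.≈ᴹ-refl })
                                  (λ { zero ne → contradiction ≡.refl ne ; (suc _) _ → V.≈ᴹ-refl }))

    scale-head : ∀ r v {p} {w : Vector V.Carrierᴹ p} → gen (r V.*ₗ v F.∷ w) ~ r ⊙ gen (v F.∷ w)
    scale-head r v = multi (scale zero r V.≈ᴹ-refl
      (λ { zero ne → contradiction ≡.refl ne ; (suc _) _ → V.≈ᴹ-refl }))

    zero-head : ∀ {p} {w : Vector V.Carrierᴹ p} → gen (V.0ᴹ F.∷ w) ~ 𝟘
    zero-head = ~-trans (cong-head (V.≈ᴹ-sym (V.*ₗ-zeroˡ V.0ᴹ))) (~-trans (scale-head _ _) (⊙-zeroˡ _))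

  square-head : ∀ u {p} {w : Vector V.Carrierᴹ p} →
                Generated K (PowerRel ext (suc (suc p))) (gen (u F.∷ u F.∷ w)) 𝟘
  square-head u = rel (repeated {i = zero} {j = suc zero} _ (λ ()) V.≈ᴹ-refl)

  -- For `ext`, the square of `u + v` vanishes; expanding it and dropping the squares of `u` and `v`
  -- leaves the two mixed terms with sum zero.
  swap-head : ∀ k u v {p} (w : Vector V.Carrierᴹ p) →
              Generated K (PowerRel k (suc (suc p))) (gen (u F.∷ v F.∷ w)) (sign {K = K} k ⊙ gen (v F.∷ u F.∷ w))
  swap-head sym u v w = ~-trans
    (~-trans (gen-cong sym λ { zero → V.≈ᴹ-refl ; (suc zero) → V.≈ᴹ-refl ; (suc (suc l)) → V.≈ᴹ-refl })
      (rel (permute (Perm.swap Perm.id) (v F.∷ u F.∷ w))))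
    (~-sym (⊙-identity _))
  swap-head ext u v {p} w = inverseˡ-unique (gen (u F.∷ v F.∷ w)) (gen (v F.∷ u F.∷ w)) (begin
    gen (u F.∷ v F.∷ w) ⊕ gen (v F.∷ u F.∷ w)
      ≈⟨ ⊕-cong (≈.+ᴹ-identityˡ _) (≈.+ᴹ-identityʳ _) ⟨
    (𝟘 ⊕ gen (u F.∷ v F.∷ w)) ⊕ (gen (v F.∷ u F.∷ w) ⊕ 𝟘)
      ≈⟨ ⊕-cong (⊕-cong (square-head u) ~-refl) (⊕-cong ~-refl (square-head v)) ⟨
    (gen (u F.∷ u F.∷ w) ⊕ gen (u F.∷ v F.∷ w)) ⊕ (gen (v F.∷ u F.∷ w) ⊕ gen (v F.∷ v F.∷ w))
      ≈⟨ ⊕-cong (cons-cong ext u (add-head ext u v)) (cons-cong ext v (add-head ext u v)) ⟨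
    gen (u F.∷ u V.+ᴹ v F.∷ w) ⊕ gen (v F.∷ u V.+ᴹ v F.∷ w)
      ≈⟨ add-head ext u v ⟨
    gen (u V.+ᴹ v F.∷ u V.+ᴹ v F.∷ w)
      ≈⟨ square-head (u V.+ᴹ v) ⟩
    𝟘 ∎)
    where
    module ≈ = Module (Power ext (suc (suc p)))
    open GroupProperties ≈.+ᴹ-group using (inverseˡ-unique)
    open import Relation.Binary.Reasoning.Setoid ≈.≈ᴹ-setoid

  -- Sorting products of basis vectors

  module _ (k : Kind) where
    private
      infix 4 _~_
      _~_ : ∀ {p} → Rel (Comb K (Vector V.Carrierᴹ p)) (c ⊔ ℓ ⊔ m ⊔ ℓm)
      _~_ {p} = Generated K (PowerRel k p)

    monomial : ∀ {n p} → (Fin n → V.Carrierᴹ) → Idx k n p → Comb K (Vector V.Carrierᴹ p)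
    monomial e M = gen (e ∘ labels M)

    -- The scalar `s` stands for a sign; being its own inverse is all that `rebase` asks of it. The
    -- multiplicities `a` are carried along because they pin down `idx`.
    record SignedMonomial {n p} (e : Fin n → V.Carrierᴹ) (y : Comb K (Vector V.Carrierᴹ p))
                          (a : Vec ℕ n) : Set (c ⊔ ℓ ⊔ m ⊔ ℓm) where
      constructor signed
      field
        s     : K.Carrier
        idx   : Idx k n p
        s²≈1  : s K.* s K.≈ K.1#
        ≈s⊙   : y ~ s ⊙ monomial e idx
        count : counts idx ≡ a

    -- The possible outcomes of sorting; the zero case arises when a label already present is
    -- inserted into an exterior monomial.
    ZeroOrSigned : ∀ {n p} → (Fin n → V.Carrierᴹ) → Comb K (Vector V.Carrierᴹ p) → Vec ℕ n →
                   Set (c ⊔ ℓ ⊔ m ⊔ ℓm)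
    ZeroOrSigned e y a = (y ~ 𝟘) ⊎ SignedMonomial e y a

  module _ {k : Kind} where
    private
      infix 4 _~_
      _~_ : ∀ {p} → Rel (Comb K (Vector V.Carrierᴹ p)) (c ⊔ ℓ ⊔ m ⊔ ℓm)
      _~_ {p} = Generated K (PowerRel k p)

    resp-signed : ∀ {n p} {e : Fin n → V.Carrierᴹ} {y z : Comb K (Vector V.Carrierᴹ p)} {a} →
                  y ~ z → ZeroOrSigned k e z a → ZeroOrSigned k e y a
    resp-signed y~z (inj₁ z~0)                   = inj₁ (~-trans y~z z~0)
    resp-signed y~z (inj₂ (signed s M s² z~ eq)) = inj₂ (signed s M s² (~-trans y~z z~) eq)

    scale-signed : ∀ {n p} {e : Fin n → V.Carrierᴹ} {y : Comb K (Vector V.Carrierᴹ p)} {a} r →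
                   r K.* r K.≈ K.1# → ZeroOrSigned k e y a → ZeroOrSigned k e (r ⊙ y) a
    scale-signed r r² (inj₁ y~0) = inj₁ (~-trans (⊙-cong K.refl y~0) (⊙-zeroʳ r))
    scale-signed r r² (inj₂ (signed s M s² y~ eq)) = inj₂ (signed (r K.* s) M
      (K.trans (interchange r s r s) (K.trans (K.*-cong r² s²) (K.*-identityˡ _)))
      (~-trans (⊙-cong K.refl y~) (~-sym (⊙-assoc r s _))) eq)
      where open CommutativeSemigroupProperties K.*-commutativeSemigroup using (interchange)

    skip-signed : ∀ {n p} {e : Fin (suc n) → V.Carrierᴹ} {y : Comb K (Vector V.Carrierᴹ p)} {a} →
                  ZeroOrSigned k (e ∘ suc) y a → ZeroOrSigned k e y (0 ∷ a)
    skip-signed (inj₁ y~0)                   = inj₁ y~0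
    skip-signed (inj₂ (signed s M s² y~ eq)) = inj₂ (signed s (skip M) s² y~ (≡.cong (0 ∷_) eq))

    monomial-signed : ∀ {n p} {e : Fin n → V.Carrierᴹ} {y : Comb K (Vector V.Carrierᴹ p)} →
                      (M : Idx k n p) → y ~ monomial k e M → ZeroOrSigned k e y (counts M)
    monomial-signed M y~ = inj₂ (signed K.1# M (K.*-identityˡ _)
      (~-trans y~ (~-sym (⊙-identity _))) ≡.refl)

    swap-signed : ∀ {n p} {e : Fin n → V.Carrierᴹ} {u v} {w : Vector V.Carrierᴹ p} {a} →
      ZeroOrSigned k e (gen (u F.∷ v F.∷ w)) a → ZeroOrSigned k e (gen (v F.∷ u F.∷ w)) a
    swap-signed {u = u} {v} {w} z = resp-signed (swap-head k v u w) (scale-signed _ (sign² {K = K} k) z)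

  take-signed-sym : ∀ {n p} {e : Fin (suc n) → V.Carrierᴹ} {y : Comb K (Vector V.Carrierᴹ p)} {a} →
    ZeroOrSigned sym e y a → ZeroOrSigned sym e (cons sym (e zero) y) (inc zero a)
  take-signed-sym (inj₁ y~0)                   = inj₁ (cons-cong sym _ y~0)
  take-signed-sym (inj₂ (signed s M s² y~ eq)) = inj₂ (signed s (take M) s²
    (~-trans (cons-cong sym _ y~) (⊙-cong K.refl (~-sym (gen-head∷tail sym _)))) (≡.cong (inc zero) eq))

  take-signed-ext : ∀ {n p} {e : Fin (suc n) → V.Carrierᴹ} {y : Comb K (Vector V.Carrierᴹ p)} {a} →
    ZeroOrSigned ext (e ∘ suc) y a → ZeroOrSigned ext e (cons ext (e zero) y) (1 ∷ a)
  take-signed-ext (inj₁ y~0)                   = inj₁ (cons-cong ext _ y~0)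
  take-signed-ext (inj₂ (signed s M s² y~ eq)) = inj₂ (signed s (take M) s²
    (~-trans (cons-cong ext _ y~) (⊙-cong K.refl (~-sym (gen-head∷tail ext _)))) (≡.cong (1 ∷_) eq))

  inc-comm : ∀ {n} (l : Fin n) (a : Vec ℕ (suc n)) → inc zero (inc (suc l) a) ≡ inc (suc l) (inc zero a)
  inc-comm l (_ ∷ _) = ≡.refl

  -- Insertion sort: a label above the leading one is swapped past it at the cost of `sign k` and
  -- inserted into the rest. A label equal to the leading one is repeated for `sym` and gives zero
  -- for `ext`.
  insert : ∀ k {n p} (e : Fin n → V.Carrierᴹ) l (M : Idx k n p) →
           ZeroOrSigned k e (gen (e l F.∷ e ∘ labels M)) (inc l (counts M))
  insert sym e zero    M        = monomial-signed (take M) (~-sym (gen-head∷tail sym _))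
  insert sym e (suc l) (take M) = ≡.subst (ZeroOrSigned sym e _) (inc-comm l (counts M))
    (resp-signed (cons-cong sym _ (gen-head∷tail sym _))
      (swap-signed (take-signed-sym (insert sym e (suc l) M))))
  insert ext e zero    (skip M) = monomial-signed (take M) (~-sym (gen-head∷tail ext _))
  insert ext e zero    (take M) = inj₁ (~-trans (cons-cong ext _ (gen-head∷tail ext _)) (square-head _))
  insert ext e (suc l) (take M) = resp-signed (cons-cong ext _ (gen-head∷tail ext _))
      (swap-signed (take-signed-ext (insert ext (e ∘ suc) l M)))
  insert sym e (suc l) (skip M) = skip-signed (insert sym (e ∘ suc) l M)
  insert ext e (suc l) (skip M) = skip-signed (insert ext (e ∘ suc) l M)

  insert-signed : ∀ k {n p} (e : Fin n → V.Carrierᴹ) l {y : Comb K (Vector V.Carrierᴹ p)} {a} →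
    ZeroOrSigned k e y a → ZeroOrSigned k e (cons k (e l) y) (inc l a)
  insert-signed k e l (inj₁ y~0)                       = inj₁ (cons-cong k _ y~0)
  insert-signed k e l (inj₂ (signed s M s² y~ ≡.refl)) =
    resp-signed (cons-cong k _ y~) (scale-signed s s² (insert k e l M))

  -- The recursive call has already sorted the relabelled tail, so inserting the image of the head
  -- label suffices.
  relabel : ∀ k {n n′ p} (e : Fin n′ → V.Carrierᴹ) (ι : Fin n → Fin n′) (M : Idx k n p) →
            ZeroOrSigned k e (gen (e ∘ ι ∘ labels M)) (push ι (counts M))
  relabel k e ι [] = ≡.subst (ZeroOrSigned k e _) (counts-empty _)
    (monomial-signed (empty _) (gen-cong k λ ()))
  relabel k   e ι (skip M) = relabel k e (ι ∘ suc) M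
  relabel sym e ι (take M) = ≡.subst (ZeroOrSigned sym e _) (≡.sym (push-inc ι (counts M)))
    (resp-signed (gen-head∷tail sym _) (insert-signed sym e (ι zero) (relabel sym e ι M)))
  relabel ext e ι (take M) =
    resp-signed (gen-head∷tail ext _) (insert-signed ext e (ι zero) (relabel ext e (ι ∘ suc) M))

  module _ (k : Kind) {n : ℕ} {e : Fin n → V.Carrierᴹ} (spanning : ∀ v → Span V e v) where
    private
      Spanned : ∀ {p} → Comb K (Vector V.Carrierᴹ p) → Set (c ⊔ ℓ ⊔ m ⊔ ℓm)
      Spanned {p} = Span (Power k p) (monomial k e)

      signed-spanned : ∀ {p} {y : Comb K (Vector V.Carrierᴹ p)} {a} → ZeroOrSigned k e y a → Spanned y
      signed-spanned (inj₁ y~0)                  = resp (~-sym y~0) zero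
      signed-spanned (inj₂ (signed s M _ y~ _)) = resp (~-sym y~) (scale s (base M))

      cons-base-spanned : ∀ {p v} → Span V e v → (M : Idx k n p) → Spanned (gen (v F.∷ e ∘ labels M))
      cons-base-spanned (base l)    M = signed-spanned (insert k e l M)
      cons-base-spanned zero        M = resp (~-sym (zero-head k)) zero
      cons-base-spanned (plus s t)  M = resp (~-sym (add-head k _ _))
        (plus (cons-base-spanned s M) (cons-base-spanned t M))
      cons-base-spanned (scale r s) M = resp (~-sym (scale-head k r _)) (scale r (cons-base-spanned s M))
      cons-base-spanned (resp e s)  M = resp (cong-head k e) (cons-base-spanned s M)

      cons-spanned : ∀ v {p} {y : Comb K (Vector V.Carrierᴹ p)} → Spanned y → Spanned (cons k v y)
      cons-spanned v (base M)    = cons-base-spanned (spanning v) M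
      cons-spanned v zero        = zero
      cons-spanned v (plus s t)  = plus (cons-spanned v s) (cons-spanned v t)
      cons-spanned v (scale r s) = scale r (cons-spanned v s)
      cons-spanned v (resp e s)  = resp (cons-cong k v e) (cons-spanned v s)

    -- Expand the head in `e` and the tail in monomials; each resulting product of one basis vector
    -- with a monomial is sorted by `insert`.
    monomials-span : ∀ {p} (v : Vector V.Carrierᴹ p) → Span (Power k p) (monomial k e) (gen v)
    monomials-span {zero}  v = resp (gen-cong k λ ()) (base (empty n))
    monomials-span {suc p} v = resp (~-sym (gen-head∷tail k v))
      (cons-spanned (v zero) (monomials-span (v ∘ suc)))

-- Linear independence of the monomials

-- The multiplicity of the least label distinguishes `skip` from `take`.
counts-injective : ∀ {k n p} (M M′ : Idx k n p) → counts M ≡ counts M′ → M ≡ M′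
counts-injective []       []        _  = ≡.refl
counts-injective (skip M) (skip M′) eq = ≡.cong skip (counts-injective M M′ (Vec.∷-injectiveʳ eq))
counts-injective {sym} (skip M) (take M′) eq with _ ∷ _ ← counts M′ = contradiction (Vec.∷-injectiveˡ eq) λ ()
counts-injective {sym} (take M) (skip M′) eq with _ ∷ _ ← counts M  = contradiction (Vec.∷-injectiveˡ eq) λ ()
counts-injective {sym} (take M) (take M′) eq = ≡.cong take (counts-injective M M′ (inc-injective eq))
  where
  inc-injective : ∀ {n} {a b : Vec ℕ (suc n)} → inc zero a ≡ inc zero b → a ≡ b
  inc-injective {a = _ ∷ _} {_ ∷ _} ≡.refl = ≡.refl
counts-injective {ext} (take M) (take M′) eq = ≡.cong take (counts-injective M M′ (Vec.∷-injectiveʳ eq))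

module _ (K : CommutativeRing c ℓ) where
  private
    module K = CommutativeRing K
    open K using (_≈_; 0#; 1#)
    open import Relation.Binary.Reasoning.Setoid K.setoid
    open RingProperties K.ring using (-‿distribˡ-*)
    open NaturalSolver K.commutativeSemiring using (solve; _:=_; _:+_; _:*_)

    σ : Kind → K.Carrier
    σ = sign {K = K}

  delta : ∀ {n} → Vec ℕ n → Vec ℕ n → K.Carrier
  delta []          []          = 1#
  delta (zero ∷ a)  (zero ∷ b)  = delta a b
  delta (zero ∷ a)  (suc y ∷ b) = 0#
  delta (suc x ∷ a) (zero ∷ b)  = 0#
  delta (suc x ∷ a) (suc y ∷ b) = delta (x ∷ a) (y ∷ b)

  delta-same : ∀ {n} (a : Vec ℕ n) → delta a a ≈ 1#
  delta-same []          = K.refl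
  delta-same (zero ∷ a)  = delta-same a
  delta-same (suc x ∷ a) = delta-same (x ∷ a)

  delta-diff : ∀ {n} {a b : Vec ℕ n} → a ≢ b → delta a b ≈ 0#
  delta-diff {a = []}        {[]}        a≢b = contradiction ≡.refl a≢b
  delta-diff {a = zero ∷ a}  {zero ∷ b}  a≢b = delta-diff (a≢b ∘ ≡.cong (0 ∷_))
  delta-diff {a = zero ∷ a}  {suc y ∷ b} a≢b = K.refl
  delta-diff {a = suc x ∷ a} {zero ∷ b}  a≢b = K.refl
  delta-diff {a = suc x ∷ a} {suc y ∷ b} a≢b = delta-diff (a≢b ∘ ≡.cong (inc zero) {x ∷ a} {y ∷ b})

  delta-inc-0 : ∀ {n} (a : Vec ℕ (suc n)) b → delta (inc zero a) (0 ∷ b) ≡ 0#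
  delta-inc-0 (_ ∷ _) b = ≡.refl

  delta-inc-suc : ∀ {n} (a : Vec ℕ (suc n)) y b → delta (inc zero a) (suc y ∷ b) ≡ delta a (y ∷ b)
  delta-inc-suc (_ ∷ _) y b = ≡.refl

  -- A function on exponent vectors is a formal combination of monomials in commuting (sym) or
  -- anticommuting (ext) variables; times w multiplies it on the left by the linear form
  -- ∑ⱼ wⱼ xⱼ.  At exponent y + 1 of x₀, α is the coefficient of x₀ · x₀^y and β the sign of moving
  -- another xⱼ past x₀^(y+1).  Both are set to 0 where x₀² = 0 makes the monomial vanish.
  α β : Kind → ℕ → K.Carrier
  α sym _       = 1#
  α ext zero    = 1#
  α ext (suc _) = 0#
  β sym _       = 1#
  β ext zero    = K.- 1#
  β ext (suc _) = 0#

  times : ∀ (k : Kind) {n} → (Fin n → K.Carrier) → (Vec ℕ n → K.Carrier) → Vec ℕ n → K.Carrier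
  times k w f []          = 0#
  times k w f (zero ∷ a)  = times k (w ∘ suc) (f ∘ (0 ∷_)) a
  times k w f (suc y ∷ a) = α k y K.* (w zero K.* f (y ∷ a)) K.+
                            β k y K.* times k (w ∘ suc) (f ∘ (suc y ∷_)) a

  prod : ∀ (k : Kind) {n p} → Vector (Fin n → K.Carrier) p → Vec ℕ n → K.Carrier
  prod k {n} {zero}  w = delta (Vec.replicate n 0)
  prod k {n} {suc p} w = times k (w zero) (prod k (w ∘ suc))

  private
    -- This and the next two identities are the sign rules behind `times-comm`; stating them for all
    -- `k` lets a single computation cover commuting and anticommuting variables.
    β*α : ∀ k → β k 0 K.* α k 0 ≈ σ k K.* α k 0
    β*α sym = K.refl
    β*α ext = K.refl

    α*α : ∀ k y → α k (suc y) K.* α k y ≈ σ k K.* (α k (suc y) K.* α k y)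
    α*α sym y = K.sym (K.*-identityˡ _)
    α*α ext y = K.trans (K.zeroˡ _) (K.sym (K.trans (K.*-congˡ (K.zeroˡ _)) (K.zeroʳ _)))

    α*β : ∀ k y → α k (suc y) K.* β k y ≈ σ k K.* (β k (suc y) K.* α k (suc y))
    α*β sym y = K.sym (K.*-identityˡ _)
    α*β ext y = K.trans (K.zeroˡ _) (K.sym (K.trans (K.*-congˡ (K.zeroˡ _)) (K.zeroʳ _)))

  module _ {k : Kind} where

    times-cong : ∀ {n} {w w′ : Fin n → K.Carrier} {f f′} → (∀ l → w l ≈ w′ l) → (∀ a → f a ≈ f′ a) →
                 ∀ a → times k w f a ≈ times k w′ f′ a
    times-cong w≈ f≈ []          = K.refl
    times-cong w≈ f≈ (zero ∷ a)  = times-cong (w≈ ∘ suc) (λ a → f≈ (0 ∷ a)) a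
    times-cong w≈ f≈ (suc y ∷ a) = K.+-cong (K.*-congˡ (K.*-cong (w≈ zero) (f≈ (y ∷ a))))
      (K.*-congˡ (times-cong (w≈ ∘ suc) (λ a → f≈ (suc y ∷ a)) a))

    times-addʳ : ∀ {n} (w : Fin n → K.Carrier) f f′ a →
                 times k w (λ a → f a K.+ f′ a) a ≈ times k w f a K.+ times k w f′ a
    times-addʳ w f f′ []          = K.sym (K.+-identityˡ _)
    times-addʳ w f f′ (zero ∷ a)  = times-addʳ (w ∘ suc) _ _ a
    times-addʳ w f f′ (suc y ∷ a) = K.trans (K.+-congˡ (K.*-congˡ (times-addʳ (w ∘ suc) _ _ a)))
      (solve 7 (λ α w p q β r s → α :* (w :* (p :+ q)) :+ β :* (r :+ s) :=
                 (α :* (w :* p) :+ β :* r) :+ (α :* (w :* q) :+ β :* s)) K.refl _ _ _ _ _ _ _)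

    times-scaleʳ : ∀ {n} (w : Fin n → K.Carrier) r f a →
                   times k w (λ a → r K.* f a) a ≈ r K.* times k w f a
    times-scaleʳ w r f []          = K.sym (K.zeroʳ _)
    times-scaleʳ w r f (zero ∷ a)  = times-scaleʳ (w ∘ suc) r _ a
    times-scaleʳ w r f (suc y ∷ a) = K.trans (K.+-congˡ (K.*-congˡ (times-scaleʳ (w ∘ suc) r _ a)))
      (solve 6 (λ α w r p β q → α :* (w :* (r :* p)) :+ β :* (r :* q) :=
                 r :* (α :* (w :* p) :+ β :* q)) K.refl _ _ _ _ _ _)

    times-addˡ : ∀ {n} (w w′ : Fin n → K.Carrier) f a →
                 times k (λ l → w l K.+ w′ l) f a ≈ times k w f a K.+ times k w′ f a
    times-addˡ w w′ f []          = K.sym (K.+-identityˡ _)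
    times-addˡ w w′ f (zero ∷ a)  = times-addˡ (w ∘ suc) (w′ ∘ suc) _ a
    times-addˡ w w′ f (suc y ∷ a) = K.trans (K.+-congˡ (K.*-congˡ (times-addˡ (w ∘ suc) (w′ ∘ suc) _ a)))
      (solve 7 (λ α w w′ p β r s → α :* ((w :+ w′) :* p) :+ β :* (r :+ s) :=
                 (α :* (w :* p) :+ β :* r) :+ (α :* (w′ :* p) :+ β :* s)) K.refl _ _ _ _ _ _ _)

    times-scaleˡ : ∀ {n} r (w : Fin n → K.Carrier) f a →
                   times k (λ l → r K.* w l) f a ≈ r K.* times k w f a
    times-scaleˡ r w f []          = K.sym (K.zeroʳ _)
    times-scaleˡ r w f (zero ∷ a)  = times-scaleˡ r (w ∘ suc) _ a
    times-scaleˡ r w f (suc y ∷ a) = K.trans (K.+-congˡ (K.*-congˡ (times-scaleˡ r (w ∘ suc) _ a)))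
      (solve 6 (λ α w r p β q → α :* ((r :* w) :* p) :+ β :* (r :* q) :=
                 r :* (α :* (w :* p) :+ β :* q)) K.refl _ _ _ _ _ _)

    times-0ʳ : ∀ {n} (w : Fin n → K.Carrier) {f} → (∀ a → f a ≈ 0#) → ∀ a → times k w f a ≈ 0#
    times-0ʳ w {f} f≈0 a = K.trans
      (times-cong (λ _ → K.refl) (λ a → K.trans (f≈0 a) (K.sym (K.zeroˡ (f a)))) a)
      (K.trans (times-scaleʳ w 0# f a) (K.zeroˡ _))

    times-0ˡ : ∀ {n} {w : Fin n → K.Carrier} f → (∀ l → w l ≈ 0#) → ∀ a → times k w f a ≈ 0#
    times-0ˡ {w = w} f w≈0 a = K.trans
      (times-cong (λ l → K.trans (w≈0 l) (K.sym (K.zeroˡ (w l)))) (λ _ → K.refl) a)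
      (K.trans (times-scaleˡ 0# w f a) (K.zeroˡ _))

    times-lincomb : ∀ {n} (v : Fin n → K.Carrier) x r f y f′ a →
      times k v (λ a → x K.* (r K.* f a) K.+ y K.* f′ a) a ≈
      x K.* (r K.* times k v f a) K.+ y K.* times k v f′ a
    times-lincomb v x r f y f′ a = K.trans (times-addʳ v _ _ a) (K.+-cong
      (K.trans (times-scaleʳ v x _ a) (K.*-congˡ (times-scaleʳ v r _ a))) (times-scaleʳ v y _ a))

    σσ : ∀ x → σ k K.* (σ k K.* x) ≈ x
    σσ x = K.trans (K.sym (K.*-assoc _ _ _)) (K.trans (K.*-congʳ (sign² {K = K} k)) (K.*-identityˡ x))

    -- Coefficients are compared by the exponent of `x₀`. Exponent 0 concerns only the other
    -- variables; exponent 1 adds the two mixed terms, where one form contributes `x₀`; from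
    -- exponent 2 on both forms may contribute it.
    times-comm : ∀ {n} (v w : Fin n → K.Carrier) f a →
                 times k v (times k w f) a ≈ σ k K.* times k w (times k v f) a
    times-comm v w f []               = K.sym (K.zeroʳ _)
    times-comm v w f (zero ∷ a)       = times-comm (v ∘ suc) (w ∘ suc) (f ∘ (0 ∷_)) a
    times-comm v w f (suc zero ∷ a)   = begin
      α₀ K.* (v₀ K.* A) K.+ β₀ K.* times k v′ (λ a → α₀ K.* (w₀ K.* f (0 ∷ a)) K.+ β₀ K.* times k w′ f₁ a) a
        ≈⟨ K.+-congˡ (K.*-congˡ (K.trans (times-lincomb v′ α₀ w₀ _ β₀ _ a)
             (K.+-congˡ (K.*-congˡ (times-comm v′ w′ f₁ a))))) ⟩
      α₀ K.* (v₀ K.* A) K.+ β₀ K.* (α₀ K.* (w₀ K.* B) K.+ β₀ K.* (σ k K.* Y))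
        ≈⟨ solve 8 (λ α β σ v w A B Y →
             α :* (v :* A) :+ β :* (α :* (w :* B) :+ β :* (σ :* Y)) :=
             α :* (v :* A) :+ ((β :* α) :* (w :* B) :+ σ :* (β :* β :* Y))) K.refl α₀ β₀ (σ k) v₀ w₀ A B Y ⟩
      α₀ K.* (v₀ K.* A) K.+ ((β₀ K.* α₀) K.* (w₀ K.* B) K.+ σ k K.* (β₀ K.* β₀ K.* Y))
        -- A factor `σ k` is produced in each mixed term: in the first by writing `α₀` as `σ k`
        -- times `σ k * α₀`, in the second directly by `β*α`.
        ≈⟨ K.+-cong (K.*-congʳ (K.sym (K.trans (K.*-congˡ (β*α k)) (σσ α₀)))) (K.+-congʳ (K.*-congʳ (β*α k))) ⟩
      (σ k K.* (β₀ K.* α₀)) K.* (v₀ K.* A) K.+ ((σ k K.* α₀) K.* (w₀ K.* B) K.+ σ k K.* (β₀ K.* β₀ K.* Y))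
        ≈⟨ solve 8 (λ α β σ v w A B Y →
             (σ :* (β :* α)) :* (v :* A) :+ ((σ :* α) :* (w :* B) :+ σ :* (β :* β :* Y)) :=
             σ :* (α :* (w :* B) :+ β :* (α :* (v :* A) :+ β :* Y))) K.refl α₀ β₀ (σ k) v₀ w₀ A B Y ⟩
      σ k K.* (α₀ K.* (w₀ K.* B) K.+ β₀ K.* (α₀ K.* (v₀ K.* A) K.+ β₀ K.* Y))
        ≈⟨ K.*-congˡ (K.+-congˡ (K.*-congˡ (times-lincomb w′ α₀ v₀ _ β₀ _ a))) ⟨
      σ k K.* times k w (times k v f) (1 ∷ a) ∎
      where
      α₀ = α k 0 ; β₀ = β k 0 ; v₀ = v zero ; w₀ = w zero ; v′ = v ∘ suc ; w′ = w ∘ suc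
      f₁ = f ∘ (1 ∷_)
      A = times k w′ (f ∘ (0 ∷_)) a
      B = times k v′ (f ∘ (0 ∷_)) a
      Y = times k w′ (times k v′ f₁) a
    times-comm v w f (suc (suc y) ∷ a) = begin
      α₁ K.* (v₀ K.* (α₀ K.* (w₀ K.* P) K.+ β₀ K.* A)) K.+
        β₁ K.* times k v′ (λ a → α₁ K.* (w₀ K.* f (suc y ∷ a)) K.+ β₁ K.* times k w′ f₂ a) a
        ≈⟨ K.+-congˡ (K.*-congˡ (K.trans (times-lincomb v′ α₁ w₀ _ β₁ _ a)
             (K.+-congˡ (K.*-congˡ (times-comm v′ w′ f₂ a))))) ⟩
      α₁ K.* (v₀ K.* (α₀ K.* (w₀ K.* P) K.+ β₀ K.* A)) K.+ β₁ K.* (α₁ K.* (w₀ K.* B) K.+ β₁ K.* (σ k K.* Y))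
        ≈⟨ solve 11 (λ α β α′ β′ σ v w A B P Y →
             α :* (v :* (α′ :* (w :* P) :+ β′ :* A)) :+ β :* (α :* (w :* B) :+ β :* (σ :* Y)) :=
             (α :* α′) :* (v :* w :* P) :+ ((α :* β′) :* (v :* A) :+ ((β :* α) :* (w :* B) :+ σ :* (β :* β :* Y))))
             K.refl α₁ β₁ α₀ β₀ (σ k) v₀ w₀ A B P Y ⟩
      (α₁ K.* α₀) K.* (v₀ K.* w₀ K.* P) K.+ ((α₁ K.* β₀) K.* (v₀ K.* A) K.+
        ((β₁ K.* α₁) K.* (w₀ K.* B) K.+ σ k K.* (β₁ K.* β₁ K.* Y)))
        -- The term with `P` is handled by `α*α`; the mixed terms use `α*β` in both directions, the
        -- second time with the square of `σ k` being 1.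
        ≈⟨ K.+-cong (K.*-congʳ (α*α k y)) (K.+-cong (K.*-congʳ (α*β k y)) (K.+-congʳ (K.*-congʳ
             (K.sym (K.trans (K.*-congˡ (α*β k y)) (σσ _)))))) ⟩
      (σ k K.* (α₁ K.* α₀)) K.* (v₀ K.* w₀ K.* P) K.+ ((σ k K.* (β₁ K.* α₁)) K.* (v₀ K.* A) K.+
        ((σ k K.* (α₁ K.* β₀)) K.* (w₀ K.* B) K.+ σ k K.* (β₁ K.* β₁ K.* Y)))
        ≈⟨ solve 11 (λ α β α′ β′ σ v w A B P Y →
             (σ :* (α :* α′)) :* (v :* w :* P) :+ ((σ :* (β :* α)) :* (v :* A) :+
               ((σ :* (α :* β′)) :* (w :* B) :+ σ :* (β :* β :* Y))) :=
             σ :* (α :* (w :* (α′ :* (v :* P) :+ β′ :* B)) :+ β :* (α :* (v :* A) :+ β :* Y)))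
             K.refl α₁ β₁ α₀ β₀ (σ k) v₀ w₀ A B P Y ⟩
      σ k K.* (α₁ K.* (w₀ K.* (α₀ K.* (v₀ K.* P) K.+ β₀ K.* B)) K.+ β₁ K.* (α₁ K.* (v₀ K.* A) K.+ β₁ K.* Y))
        ≈⟨ K.*-congˡ (K.+-congˡ (K.*-congˡ (times-lincomb w′ α₁ v₀ _ β₁ _ a))) ⟨
      σ k K.* times k w (times k v f) (suc (suc y) ∷ a) ∎
      where
      α₀ = α k y ; β₀ = β k y ; α₁ = α k (suc y) ; β₁ = β k (suc y)
      v₀ = v zero ; w₀ = w zero ; v′ = v ∘ suc ; w′ = w ∘ suc
      f₂ = f ∘ (suc (suc y) ∷_)
      P = f (y ∷ a)
      A = times k w′ (f ∘ (suc y ∷_)) a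
      B = times k v′ (f ∘ (suc y ∷_)) a
      Y = times k w′ (times k v′ f₂) a

    prod-cong : ∀ {n p} {w w′ : Vector (Fin n → K.Carrier) p} → (∀ l l′ → w l l′ ≈ w′ l l′) →
                ∀ a → prod k w a ≈ prod k w′ a
    prod-cong {p = zero}  w≈ a = K.refl
    prod-cong {p = suc p} w≈ a = times-cong (w≈ zero) (prod-cong (w≈ ∘ suc)) a

    prod-add : ∀ {n p} l {u v w : Vector (Fin n → K.Carrier) p} →
      (∀ l′ → w l l′ ≈ u l l′ K.+ v l l′) →
      (∀ j → j ≢ l → ∀ l′ → w j l′ ≈ u j l′) → (∀ j → j ≢ l → ∀ l′ → w j l′ ≈ v j l′) →
      ∀ a → prod k w a ≈ prod k u a K.+ prod k v a
    prod-add zero {u} {v} {w} e e′ e″ a = K.trans (times-cong e (λ _ → K.refl) a)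
      (K.trans (times-addˡ (u zero) (v zero) _ a) (K.+-cong
        (times-cong (λ _ → K.refl) (prod-cong λ j → e′ (suc j) λ ()) a)
        (times-cong (λ _ → K.refl) (prod-cong λ j → e″ (suc j) λ ()) a)))
    prod-add (suc l) {u} {v} {w} e e′ e″ a = K.trans
      (times-cong (λ _ → K.refl) (prod-add l e (λ j ne → e′ (suc j) (ne ∘ Fin.suc-injective))
                                             (λ j ne → e″ (suc j) (ne ∘ Fin.suc-injective))) a)
      (K.trans (times-addʳ (w zero) _ _ a) (K.+-cong
        (times-cong (e′ zero λ ()) (λ _ → K.refl) a)
        (times-cong (e″ zero λ ()) (λ _ → K.refl) a)))

    prod-scale : ∀ {n p} l r {v w : Vector (Fin n → K.Carrier) p} →
      (∀ l′ → w l l′ ≈ r K.* v l l′) → (∀ j → j ≢ l → ∀ l′ → w j l′ ≈ v j l′) →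
      ∀ a → prod k w a ≈ r K.* prod k v a
    prod-scale zero r {v} {w} e e′ a = K.trans (times-cong e (prod-cong λ j → e′ (suc j) λ ()) a)
      (times-scaleˡ r (v zero) _ a)
    prod-scale (suc l) r {v} {w} e e′ a = K.trans
      (times-cong (e′ zero λ ()) (prod-scale l r e (λ j ne → e′ (suc j) (ne ∘ Fin.suc-injective))) a)
      (times-scaleʳ (v zero) r _ a)

    prod-shift-0 : ∀ {n p} (f : Fin p → Fin n) a → prod k (λ l → unit K (suc (f l))) (0 ∷ a) ≈ prod k (unit K ∘ f) a
    prod-shift-0 {p = zero}  f a = K.refl
    prod-shift-0 {p = suc p} f a = times-cong (λ _ → K.refl) (prod-shift-0 (f ∘ suc)) a

    prod-shift-suc : ∀ {n p} (f : Fin p → Fin n) y a → prod k (λ l → unit K (suc (f l))) (suc y ∷ a) ≈ 0#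
    prod-shift-suc {p = zero}  f y a = K.refl
    prod-shift-suc {p = suc p} f y a = K.trans (K.+-cong
      (K.trans (K.*-congˡ (K.zeroˡ _)) (K.zeroʳ _))
      (K.trans (K.*-congˡ (times-0ʳ (unit K (f zero)) (prod-shift-suc (f ∘ suc) y) a)) (K.zeroʳ _)))
      (K.+-identityˡ _)

    times-unit-0 : ∀ {n} f (a : Vec ℕ n) → times k (unit K zero) f (0 ∷ a) ≈ 0#
    times-unit-0 f a = times-0ˡ _ (λ _ → K.refl) a

    times-unit-suc : ∀ {n} f y (a : Vec ℕ n) → times k (unit K zero) f (suc y ∷ a) ≈ α k y K.* f (y ∷ a)
    times-unit-suc f y a = K.trans (K.+-cong (K.*-congˡ (K.*-identityˡ _))
      (K.trans (K.*-congˡ (times-0ˡ _ (λ _ → K.refl) a)) (K.zeroʳ _))) (K.+-identityʳ _)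

  -- The labels increase, so each variable joins at the front, where no sign arises; for `ext` the
  -- exponent of that variable is still 0.
  prod-labels : ∀ k {n p} (M : Idx k n p) a → prod k (unit K ∘ labels M) a ≈ delta (counts M) a
  prod-labels k []       []          = K.refl
  prod-labels k (skip M) (zero ∷ a)  = K.trans (prod-shift-0 (labels M) a) (prod-labels k M a)
  prod-labels k (skip M) (suc y ∷ a) = prod-shift-suc (labels M) y a
  prod-labels sym (take M) (zero ∷ a)  = K.trans (times-unit-0 (prod sym (unit K ∘ labels M)) a)
    (K.reflexive (≡.sym (delta-inc-0 (counts M) a)))
  prod-labels sym (take M) (suc y ∷ a) = K.trans
    (times-unit-suc (prod sym (unit K ∘ labels M)) y a) (K.trans (K.*-identityˡ _)
    (K.trans (prod-labels sym M (y ∷ a)) (K.reflexive (≡.sym (delta-inc-suc (counts M) y a)))))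
  prod-labels ext (take M) (zero ∷ a)  = times-unit-0 (prod ext (λ l → unit K (suc (labels M l)))) a
  prod-labels ext (take M) (suc zero ∷ a) = K.trans
    (times-unit-suc (prod ext (λ l → unit K (suc (labels M l)))) 0 a) (K.trans (K.*-identityˡ _)
    (K.trans (prod-shift-0 (labels M) a) (prod-labels ext M a)))
  prod-labels ext (take M) (suc (suc y) ∷ a) = K.trans
    (times-unit-suc (prod ext (λ l → unit K (suc (labels M l)))) (suc y) a) (K.zeroˡ _)

  times-comm-sym : ∀ {n} (v w : Fin n → K.Carrier) f a →
                   times sym v (times sym w f) a ≈ times sym w (times sym v f) a
  times-comm-sym v w f a = K.trans (times-comm v w f a) (K.*-identityˡ _)

  prod-pull : ∀ {n p} (w : Vector (Fin n → K.Carrier) (suc p)) l a →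
              prod sym w a ≈ times sym (w l) (prod sym (w ∘ punchIn l)) a
  prod-pull             w zero    a = K.refl
  prod-pull {p = suc p} w (suc l) a = K.trans
    (times-cong (λ _ → K.refl) (prod-pull (w ∘ suc) l) a)
    (times-comm-sym (w zero) (w (suc l)) _ a)

  -- The factor at the position that `π` sends to `zero` is pulled to the front, and the rest is
  -- permuted by `π` with that position removed.
  prod-permute : ∀ {n p p′} (w : Vector (Fin n → K.Carrier) p) (π : Permutation p′ p) a →
                 prod sym w a ≈ prod sym (w ∘ (π ⟨$⟩ʳ_)) a
  prod-permute {p = zero}  {zero}   w π a = K.refl
  prod-permute {p = zero}  {suc p′} w π a = contradiction π (Perm.refute λ ())
  prod-permute {p = suc p} {zero}   w π a = contradiction π (Perm.refute λ ())
  prod-permute {p = suc p} {suc p′} w π a = begin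
    times sym (w zero) (prod sym (w ∘ suc)) a
      ≈⟨ times-cong (λ l → K.reflexive (≡.cong (λ j → w j l) (≡.sym (Perm.inverseʳ π))))
           (prod-permute (w ∘ suc) (Perm.remove π₀ π)) a ⟩
    times sym (w (π ⟨$⟩ʳ π₀)) (prod sym (w ∘ suc ∘ (Perm.remove π₀ π ⟨$⟩ʳ_))) a
      ≈⟨ times-cong (λ _ → K.refl) (prod-cong λ j l →
           K.reflexive (≡.cong (λ j → w j l) (≡.sym (Perm.punchIn-permute′ π zero j)))) a ⟩
    times sym (w (π ⟨$⟩ʳ π₀)) (prod sym (w ∘ (π ⟨$⟩ʳ_) ∘ punchIn π₀)) a
      ≈⟨ prod-pull (w ∘ (π ⟨$⟩ʳ_)) π₀ a ⟨
    prod sym (w ∘ (π ⟨$⟩ʳ_)) a ∎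
    where π₀ = π ⟨$⟩ˡ zero

  -- Anticommutation alone shows only that twice the square vanishes, and 2 may be a zero divisor in
  -- `K`. Here the two mixed terms at exponent 1 of `x₀` are cancelled explicitly.
  times-square : ∀ {n} (v : Fin n → K.Carrier) f a → times ext v (times ext v f) a ≈ 0#
  times-square v f []               = K.refl
  times-square v f (zero ∷ a)       = times-square (v ∘ suc) (f ∘ (0 ∷_)) a
  times-square v f (suc zero ∷ a)   = begin
    1# K.* X K.+ (K.- 1#) K.* times ext v′ (λ a → 1# K.* (v zero K.* f (0 ∷ a)) K.+ (K.- 1#) K.* times ext v′ f₁ a) a
      ≈⟨ K.+-congˡ (K.*-congˡ (K.trans (times-lincomb v′ 1# (v zero) _ (K.- 1#) _ a)
           (K.trans (K.+-congˡ (K.trans (K.*-congˡ (times-square v′ f₁ a)) (K.zeroʳ _))) (K.+-identityʳ _)))) ⟩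
    1# K.* X K.+ (K.- 1#) K.* (1# K.* X)
      ≈⟨ K.+-cong (K.*-identityˡ _) (K.trans (K.*-congˡ (K.*-identityˡ _))
           (K.trans (K.sym (-‿distribˡ-* 1# X)) (K.-‿cong (K.*-identityˡ X)))) ⟩
    X K.+ (K.- X)
      ≈⟨ K.-‿inverseʳ X ⟩
    0# ∎
    where
    v′ = v ∘ suc
    f₁ = f ∘ (1 ∷_)
    X = v zero K.* times ext v′ (f ∘ (0 ∷_)) a
  times-square v f (suc (suc y) ∷ a) = K.trans (K.+-cong (K.zeroˡ _) (K.zeroˡ _)) (K.+-identityˡ _)

  -- The form `v` is moved to the right by anticommutation until it meets its equal, where
  -- `times-square` applies.
  prod-absorb : ∀ {n p} {v : Fin n → K.Carrier} (w : Vector (Fin n → K.Carrier) p) l →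
                (∀ l′ → v l′ ≈ w l l′) → ∀ a → times ext v (prod ext w) a ≈ 0#
  prod-absorb w zero e a = K.trans (times-cong e (λ _ → K.refl) a) (times-square (w zero) _ a)
  prod-absorb {v = v} w (suc l) e a = K.trans (times-comm v (w zero) _ a)
    (K.trans (K.*-congˡ (times-0ʳ (w zero) (prod-absorb (w ∘ suc) l e) a)) (K.zeroʳ _))

  prod-repeated : ∀ {n p} (w : Vector (Fin n → K.Carrier) p) l l′ → l ≢ l′ →
                  (∀ j → w l j ≈ w l′ j) → ∀ a → prod ext w a ≈ 0#
  prod-repeated w zero    zero     ne e = contradiction ≡.refl ne
  prod-repeated w zero    (suc l′) ne e = prod-absorb (w ∘ suc) l′ e
  prod-repeated w (suc l) zero     ne e = prod-absorb (w ∘ suc) l (λ j → K.sym (e j))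
  prod-repeated w (suc l) (suc l′) ne e = times-0ʳ (w zero)
    (prod-repeated (w ∘ suc) l l′ (ne ∘ ≡.cong suc) e)

module _ {K : CommutativeRing c ℓ} {V : Module K m ℓm} where
  private
    module K = CommutativeRing K
    module V = Module V

  -- Entry `l` of a generator becomes the linear form with coefficients `coord (v l)`, and the
  -- coordinate at `M` is a coefficient of the product of these forms. For `ext` these are the
  -- minors of the coordinate matrix.
  powerDualBasis : ∀ k {n p} {e : Fin n → V.Carrierᴹ} → DualBasis V e →
                   DualBasis (Power V k p) (monomial V k e)
  powerDualBasis k {n} {p} {e} B = presentedDualBasis K
    (λ v M → prod K k (λ l → coord (v l)) (counts M))
    (λ M → respects k (counts M))
    (λ M → K.trans (prod-monomial M (counts M)) (delta-same K (counts M)))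
    (λ {M} {M′} ne → K.trans (prod-monomial M (counts M′)) (delta-diff K (ne ∘ counts-injective M M′)))
    (monomials-span V k spanning)
    where
    open DualBasis B

    coord-unit : ∀ l l′ → coord (e l) l′ K.≈ unit K l l′
    coord-unit l l′ with l Fin.≟ l′
    ... | yes ≡.refl = K.trans (coord-same l) (K.reflexive (≡.sym (unit-same K l)))
    ... | no l≢l′    = K.trans (coord-diff l≢l′) (K.reflexive (≡.sym (unit-diff K l≢l′)))

    prod-monomial : ∀ (M : Idx k n p) a → prod K k (λ l → coord (e (labels M l))) a K.≈ delta K (counts M) a
    prod-monomial M a = K.trans (prod-cong K (λ l → coord-unit (labels M l)) a) (prod-labels K k M a)

    φ : Kind → Vec ℕ n → Vector V.Carrierᴹ p → K.Carrier
    φ k a v = prod K k (λ l → coord (v l)) a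

    respects-multi : ∀ k a {s t} → Multilinear V p s t → extend K (φ k a) s K.≈ extend K (φ k a) t
    respects-multi k a (cong e)         = prod-cong K (λ l → coord-cong (e l)) a
    respects-multi k a (add l e e′ e″)  = prod-add K l
      (λ l′ → K.trans (coord-cong e l′) (coord-+ _ _ l′))
      (λ j ne → coord-cong (e′ j ne)) (λ j ne → coord-cong (e″ j ne)) a
    respects-multi k a (scale l r e e′) = prod-scale K l r
      (λ l′ → K.trans (coord-cong e l′) (coord-* _ _ l′)) (λ j ne → coord-cong (e′ j ne)) a

    respects : ∀ k a {s t} → PowerRel V k p s t → extend K (φ k a) s K.≈ extend K (φ k a) t
    respects sym a (multilinear e)            = respects-multi sym a e
    respects sym a (permute π v)              = K.sym (prod-permute K (λ l → coord (v l)) π a)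
    respects ext a (multilinear e)            = respects-multi ext a e
    respects ext a (repeated {l} {l′} v ne e) = prod-repeated K (λ l → coord (v l)) l l′ ne (coord-cong e) a

-- Counting

size : Kind → ℕ → ℕ → ℕ
size k zero    zero    = 1
size k zero    (suc p) = 0
size k (suc n) zero    = size k n zero
size k (suc n) (suc p) = size k n (suc p) + size k (next k n) p

Idx-split : ∀ {k n p} → (Idx k n (suc p) ⊎ Idx k (next k n) p) ↔ Idx k (suc n) (suc p)
Idx-split = mk↔ₛ′
  (λ { (inj₁ M) → skip M ; (inj₂ M) → take M })
  (λ { (skip M) → inj₁ M ; (take M) → inj₂ M })
  (λ { (skip M) → ≡.refl ; (take M) → ≡.refl })
  (λ { (inj₁ M) → ≡.refl ; (inj₂ M) → ≡.refl })

enumerate : ∀ k n p → Fin (size k n p) ↔ Idx k n p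
enumerate k zero    zero    = mk↔ₛ′ (λ _ → []) (λ _ → zero) (λ { [] → ≡.refl }) (λ { zero → ≡.refl })
enumerate k zero    (suc p) = mk↔ₛ′ (λ ()) (λ ()) (λ ()) (λ ())
enumerate k (suc n) zero    = mk↔ₛ′ skip (λ { (skip M) → M }) (λ { (skip M) → ≡.refl }) (λ _ → ≡.refl)
  ↔-∘ enumerate k n zero
enumerate k (suc n) (suc p) = Idx-split
  ↔-∘ ((enumerate k n (suc p) ⊎-↔ enumerate k (next k n) p) ↔-∘ Fin.+↔⊎)

size-ext : ∀ n p → size ext n p ≡ n C p
size-ext zero    zero    = ≡.refl
size-ext zero    (suc p) = ≡.refl
size-ext (suc n) zero    = size-ext n zero
size-ext (suc n) (suc p) = ≡.trans (≡.cong₂ _+_ (size-ext n (suc p)) (size-ext n p))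
  (≡.trans (ℕ.+-comm (n C suc p) (n C p)) (nCk+nC[k+1]≡[n+1]C[k+1] n p))

-- Stars and bars, stated at `suc n` to avoid a truncated `n + p - 1`.
size-sym : ∀ n p → size sym (suc n) p ≡ (n + p) C p
size-sym zero    zero    = ≡.refl
size-sym (suc n) zero    = size-sym n zero
size-sym zero    (suc p) = ≡.trans (size-sym zero p) (≡.trans (nCn≡1 p) (≡.sym (nCn≡1 (suc p))))
size-sym (suc n) (suc p) = begin
  size sym (suc n) (suc p) + size sym (suc (suc n)) p
    ≡⟨ ≡.cong₂ _+_ (size-sym n (suc p)) (size-sym (suc n) p) ⟩
  (n + suc p) C suc p + suc (n + p) C p
    ≡⟨ ≡.cong (λ N → (n + suc p) C suc p + N C p) (ℕ.+-suc n p) ⟨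
  (n + suc p) C suc p + (n + suc p) C p
    ≡⟨ ℕ.+-comm ((n + suc p) C suc p) _ ⟩
  (n + suc p) C p + (n + suc p) C suc p
    ≡⟨ nCk+nC[k+1]≡[n+1]C[k+1] (n + suc p) p ⟩
  suc (n + suc p) C suc p ∎
  where open ≡.≡-Reasoning

C*factorials : ∀ n p → ((n + p) C p) * (p ! * n !) ≡ (n + p) !
C*factorials n p = begin
  ((n + p) C p) * (p ! * n !)
    ≡⟨ ≡.cong (λ N → ((n + p) C p) * (p ! * N !)) (ℕ.m+n∸n≡m n p) ⟨
  ((n + p) C p) * (p ! * (n + p ∸ p) !)
    ≡⟨ ≡.cong (_* (p ! * (n + p ∸ p) !)) (nCk≡n!/k![n-k]! {n + p} {p} (ℕ.m≤n+m p n)) ⟩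
  ((n + p) ! ℕ./ (p ! * (n + p ∸ p) !)) * (p ! * (n + p ∸ p) !)
    ≡⟨ m/n*n≡m (k![n∸k]!∣n! {n + p} {p} (ℕ.m≤n+m p n)) ⟩
  (n + p) ! ∎
  where
  open ≡.≡-Reasoning
  instance
    nonZero : NonZero (p ! * (n + p ∸ p) !)
    nonZero = p ℕ.!* (n + p ∸ p) !≢0

factorials≢0 : ∀ p q m → NonZero (p ! * q ! * m !)
factorials≢0 p q m = ℕ.m*n≢0 (p ! * q !) (m !) {{p ℕ.!* q !≢0}} {{m ℕ.!≢0}}

-- With `suc n` the group order, clearing factorials gives `d * (p ! * q ! * m !) ≡ (n + p) !`, and
-- `p + q + m ≡ suc (n + p)` supplies the remaining factor of the multinomial.
orbits-count : ∀ p q m n d → q + m ≡ suc n →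
  d * suc n ≡ size sym (suc n) p * size ext (suc n) m → d * (p + q + m) ≡ multinomial p q m
orbits-count p q m n d q+m≡ d*n≡ = begin
  d * (p + q + m)
    ≡⟨ m*n/n≡m (d * (p + q + m)) _ ⟨
  (d * (p + q + m) * (p ! * q ! * m !)) ℕ./ (p ! * q ! * m !)
    ≡⟨ ≡.cong (λ z → z ℕ./ (p ! * q ! * m !)) total ⟩
  multinomial p q m ∎
  where
  open ≡.≡-Reasoning
  instance
    nonZero : NonZero (p ! * q ! * m !)
    nonZero = factorials≢0 p q m
    nonZero′ : NonZero ((suc n) !)
    nonZero′ = suc n ℕ.!≢0

  p+q+m≡ : p + q + m ≡ suc (n + p)
  p+q+m≡ = ≡.trans (ℕ.+-assoc p q m) (≡.trans (≡.cong (p +_) q+m≡) (ℕ.+-comm p (suc n)))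

  subsets : size ext (suc n) m * (m ! * q !) ≡ (suc n) !
  subsets = ≡.trans (≡.cong (_* (m ! * q !)) (size-ext (suc n) m))
    (≡.subst (λ N → (N C m) * (m ! * q !) ≡ N !) q+m≡ (C*factorials q m))

  multisets : size sym (suc n) p * (p ! * n !) ≡ (n + p) !
  multisets = ≡.trans (≡.cong (_* (p ! * n !)) (size-sym n p)) (C*factorials n p)

  -- The orbit length `suc n` joins the `n !` from the multisets to form the same `(suc n) !` that
  -- the subsets produce, ready to be cancelled.
  scaled : d * (p ! * q ! * m !) * (suc n) ! ≡ (n + p) ! * (suc n) !
  scaled = begin
    d * (p ! * q ! * m !) * (suc n * n !)
      ≡⟨ solve 6 (λ d p q m N n → d :* (p :* q :* m) :* (N :* n) := (d :* N) :* ((p :* n) :* (m :* q)))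
           ≡.refl d (p !) (q !) (m !) (suc n) (n !) ⟩
    (d * suc n) * ((p ! * n !) * (m ! * q !))
      ≡⟨ ≡.cong (_* ((p ! * n !) * (m ! * q !))) d*n≡ ⟩
    (size sym (suc n) p * size ext (suc n) m) * ((p ! * n !) * (m ! * q !))
      ≡⟨ ℕ.[m*n]*[o*p]≡[m*o]*[n*p] (size sym (suc n) p) _ (p ! * n !) _ ⟩
    (size sym (suc n) p * (p ! * n !)) * (size ext (suc n) m * (m ! * q !))
      ≡⟨ ≡.cong₂ _*_ multisets subsets ⟩
    (n + p) ! * (suc n) ! ∎
    where open +-*-Solver

  total : d * (p + q + m) * (p ! * q ! * m !) ≡ (p + q + m) !
  total = begin
    d * (p + q + m) * (p ! * q ! * m !)
      ≡⟨ solve 3 (λ d N f → d :* N :* f := N :* (d :* f)) ≡.refl d (p + q + m) (p ! * q ! * m !) ⟩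
    (p + q + m) * (d * (p ! * q ! * m !))
      ≡⟨ ≡.cong ((p + q + m) *_) (ℕ.*-cancelʳ-≡ _ _ ((suc n) !) scaled) ⟩
    (p + q + m) * (n + p) !
      ≡⟨ ≡.cong (λ N → N * (n + p) !) p+q+m≡ ⟩
    (suc (n + p)) !
      ≡⟨ ≡.cong _! p+q+m≡ ⟨
    (p + q + m) ! ∎
    where open +-*-Solver

-- Free actions

sum-counts : ∀ {k n p} (M : Idx k n p) → Vec.sum (counts M) ≡ p
sum-counts             []       = ≡.refl
sum-counts             (skip M) = sum-counts M
sum-counts {k = sym}   (take M) = ≡.trans (sum-inc (counts M)) (≡.cong suc (sum-counts M))
  where
  sum-inc : ∀ {n} (a : Vec ℕ (suc n)) → Vec.sum (inc zero a) ≡ suc (Vec.sum a)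
  sum-inc (_ ∷ _) = ≡.refl
sum-counts {k = ext}   (take M) = ≡.cong suc (sum-counts M)

lookup-injective : ∀ {n} {a b : Vec ℕ n} → (∀ l → lookup a l ≡ lookup b l) → a ≡ b
lookup-injective {a = []}    {[]}    _ = ≡.refl
lookup-injective {a = _ ∷ _} {_ ∷ _} h = ≡.cong₂ _∷_ (h zero) (lookup-injective (h ∘ suc))

lookup-fold-inc : ∀ {n} (l : Fin n) a r → lookup (fold a (inc l) r) l ≡ r + lookup a l
lookup-fold-inc l a zero    = ≡.refl
lookup-fold-inc l a (suc r) = ≡.trans (Vec.lookup∘updateAt l (fold a (inc l) r)) (≡.cong suc (lookup-fold-inc l a r))

lookup-fold-inc-≢ : ∀ {n} {l l′ : Fin n} a r → l ≢ l′ → lookup (fold a (inc l) r) l′ ≡ lookup a l′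
lookup-fold-inc-≢ a zero    l≢l′ = ≡.refl
lookup-fold-inc-≢ a (suc r) l≢l′ =
  ≡.trans (Vec.lookup∘updateAt′ _ _ (l≢l′ ∘ ≡.sym) (fold a (inc _) r)) (lookup-fold-inc-≢ a r l≢l′)

lookup-push-∉ : ∀ {n n′} (ι : Fin n → Fin n′) a l → (∀ k → ι k ≢ l) → lookup (push ι a) l ≡ 0
lookup-push-∉ ι []      l l∉ = Vec.lookup-replicate l 0
lookup-push-∉ ι (r ∷ a) l l∉ =
  ≡.trans (lookup-fold-inc-≢ _ r (l∉ zero)) (lookup-push-∉ (ι ∘ suc) a l (l∉ ∘ suc))

lookup-push : ∀ {n n′} (ι : Fin n → Fin n′) → (∀ {k l} → ι k ≡ ι l → k ≡ l) →
              ∀ a l → lookup (push ι a) (ι l) ≡ lookup a l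
lookup-push ι ι-inj (r ∷ a) zero    = ≡.trans (lookup-fold-inc (ι zero) _ r)
  (≡.trans (≡.cong (r +_) (lookup-push-∉ (ι ∘ suc) a (ι zero) (λ k eq → Fin.0≢1+n (≡.sym (ι-inj eq)))))
    (ℕ.+-identityʳ r))
lookup-push ι ι-inj (r ∷ a) (suc l) = ≡.trans (lookup-fold-inc-≢ _ r (Fin.0≢1+n ∘ ι-inj))
  (lookup-push (ι ∘ suc) (Fin.suc-injective ∘ ι-inj) a l)

module _ (G : AbelianGroup g ℓg) where
  open AbelianGroup G renaming (sym to ≈-sym)
  open Mult commutativeMonoid using (×-congʳ; ×-congˡ; ×-homo-1; ×-homo-+; ×-assocˡ; ×-distrib-+)
    renaming (_×_ to _×′_)
  open CommutativeMonoidSum commutativeMonoid using (sum; sum-cong-≋; sum-permute; ∑-distrib-+)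
  open GroupProperties group using (identityˡ-unique)

  private
    ×-ε : ∀ k → k ×′ ε ≈ ε
    ×-ε zero    = refl
    ×-ε (suc k) = trans (identityˡ _) (×-ε k)

    -- Bézout's identity over the naturals keeps the negative term on the left, and one lemma serves
    -- both of its orientations.
    bézout : ∀ {a d} x y k l → k ×′ a ≈ ε → l ×′ a ≈ ε → d + y * l ≡ x * k → d ×′ a ≈ ε
    bézout {a} {d} x y k l ka≈ε la≈ε eq = begin
      d ×′ a                     ≈⟨ identityʳ _ ⟨
      d ×′ a ∙ ε                 ≈⟨ ∙-congˡ (trans (×-congʳ y la≈ε) (×-ε y)) ⟨
      d ×′ a ∙ y ×′ (l ×′ a)     ≈⟨ ∙-congˡ (×-assocˡ a y l) ⟩
      d ×′ a ∙ (y * l) ×′ a      ≈⟨ ×-homo-+ a d (y * l) ⟨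
      (d + y * l) ×′ a           ≈⟨ ×-congˡ eq ⟩
      (x * k) ×′ a               ≈⟨ ×-assocˡ a x k ⟨
      x ×′ (k ×′ a)              ≈⟨ trans (×-congʳ x ka≈ε) (×-ε x) ⟩
      ε                          ∎
      where open import Relation.Binary.Reasoning.Setoid setoid

  gcd-torsion : ∀ {a} k l → k ×′ a ≈ ε → l ×′ a ≈ ε → gcd k l ×′ a ≈ ε
  gcd-torsion k l ka≈ε la≈ε with Bézout.identity (gcd-GCD k l)
  ... | Bézout.+- x y eq = bézout x y k l ka≈ε la≈ε eq
  ... | Bézout.-+ x y eq = bézout y x l k la≈ε ka≈ε eq

  module _ {n : ℕ} (order : HasOrder group n) where
    open Inverse order using (to)

    invariant⇒torsion : ∀ a c → (∀ l → lookup c (translate group order a l) ≡ lookup c l) →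
                        Vec.sum c ×′ a ≈ ε
    invariant⇒torsion a c c-inv = identityˡ-unique (Vec.sum c ×′ a) P (begin
      Vec.sum c ×′ a ∙ P
        ≈⟨ ∙-congʳ (sum-× c) ⟨
      sum (λ l → lookup c l ×′ a) ∙ P
        ≈⟨ ∑-distrib-+ {n} _ _ ⟨
      sum (λ l → lookup c l ×′ a ∙ lookup c l ×′ to l)
        ≈⟨ sum-cong-≋ {n} (λ l → ×-distrib-+ a (to l) (lookup c l)) ⟨
      sum (λ l → lookup c l ×′ (a ∙ to l))
        ≈⟨ sum-cong-≋ {n} (λ l → trans (×-congˡ (c-inv l)) (×-congʳ (lookup c l) (to-translate group order a l))) ⟨
      sum (λ l → lookup c (translate group order a l) ×′ to (translate group order a l))
        ≈⟨ sum-permute (λ l → lookup c l ×′ to l) (translation group order a) ⟨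
      P ∎)
      where
      open import Relation.Binary.Reasoning.Setoid setoid
      P = sum (λ l → lookup c l ×′ to l)
      sum-× : ∀ {n} (c : Vec ℕ n) → sum (λ l → lookup c l ×′ a) ≈ Vec.sum c ×′ a
      sum-× []      = refl
      sum-× (r ∷ c) = trans (∙-congˡ (sum-× c)) (≈-sym (×-homo-+ a r (Vec.sum c)))

    invariant⇒trivial : ∀ p q m → q + m ≡ n → gcd (gcd p q) m ≡ 1 →
      ∀ a {k k′} (M : Idx k n p) (S : Idx k′ n m) →
      (∀ l → lookup (counts M) (translate group order a l) ≡ lookup (counts M) l) →
      (∀ l → lookup (counts S) (translate group order a l) ≡ lookup (counts S) l) →
      a ≈ ε
    invariant⇒trivial p q m q+m≡n coprime a M S M-inv S-inv = begin
      a                         ≈⟨ ×-homo-1 a ⟨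
      1 ×′ a                    ≈⟨ ×-congˡ coprime ⟨
      gcd (gcd p q) m ×′ a      ≈⟨ gcd-torsion (gcd p q) m (gcd-torsion p q pa≈ε qa≈ε) ma≈ε ⟩
      ε                         ∎
      where
      open import Relation.Binary.Reasoning.Setoid setoid
      pa≈ε : p ×′ a ≈ ε
      pa≈ε = trans (×-congˡ (≡.sym (sum-counts M))) (invariant⇒torsion a (counts M) M-inv)
      ma≈ε : m ×′ a ≈ ε
      ma≈ε = trans (×-congˡ (≡.sym (sum-counts S))) (invariant⇒torsion a (counts S) S-inv)
      sum-ones : ∀ n → Vec.sum (Vec.replicate n 1) ≡ n
      sum-ones zero    = ≡.refl
      sum-ones (suc n) = ≡.cong suc (sum-ones n)
      -- The constant multiplicity function 1 is invariant under every `a`; this is Lagrange's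
      -- theorem for an abelian group.
      na≈ε : n ×′ a ≈ ε
      na≈ε = trans (×-congˡ (≡.sym (sum-ones n))) (invariant⇒torsion a (Vec.replicate n 1)
        (λ l → ≡.trans (Vec.lookup-replicate (translate group order a l) 1) (≡.sym (Vec.lookup-replicate l 1))))
      qa≈ε : q ×′ a ≈ ε
      qa≈ε = begin
        q ×′ a              ≈⟨ identityʳ _ ⟨
        q ×′ a ∙ ε          ≈⟨ ∙-congˡ ma≈ε ⟨
        q ×′ a ∙ m ×′ a     ≈⟨ ×-homo-+ a q m ⟨
        (q + m) ×′ a        ≈⟨ ×-congˡ q+m≡n ⟩
        n ×′ a              ≈⟨ na≈ε ⟩
        ε                   ∎

-- Orbits of a free action on a finite set

-- A greedy choice: `zero` becomes a representative exactly when it is equivalent to none of those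
-- chosen from the rest, which `_~?_` decides.
representatives : ∀ {N} {_~_ : Rel (Fin N) ρ} →
  Reflexive _~_ → (∀ {y z} → y ~ z → z ~ y) → Transitive _~_ → Decidable _~_ →
  ∃₂ λ d (r : Fin d → Fin N) → (∀ y → ∃ λ o → r o ~ y) × (∀ o o′ → r o ~ r o′ → o ≡ o′)
representatives {N = zero} rfl sm tr _~?_ = 0 , (λ ()) , (λ ()) , (λ ())
representatives {N = suc N} {_~_ = _~_} rfl sm tr _~?_
  with d , r , onto , distinct ← representatives {_~_ = λ y z → suc y ~ suc z} rfl sm tr (λ y z → suc y ~? suc z)
  with Fin.any? (λ o → suc (r o) ~? zero)
... | yes (o , ro~0) = d , suc ∘ r , (λ { zero → o , ro~0 ; (suc y) → onto y }) , distinct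
... | no ¬r~0 = suc d , r′ , onto′ , distinct′
  where
  r′ : Fin (suc d) → Fin (suc N)
  r′ zero    = zero
  r′ (suc o) = suc (r o)
  onto′ : ∀ y → ∃ λ o → r′ o ~ y
  onto′ zero    = zero , rfl
  onto′ (suc y) = let o , ro~y = onto y in suc o , ro~y
  distinct′ : ∀ o o′ → r′ o ~ r′ o′ → o ≡ o′
  distinct′ zero    zero     _ = ≡.refl
  distinct′ zero    (suc o′) e = contradiction (o′ , sm e) ¬r~0
  distinct′ (suc o) zero     e = contradiction (o , e) ¬r~0
  distinct′ (suc o) (suc o′) e = ≡.cong suc (distinct o o′ e)

module _ (G : Group g ℓg) {n : ℕ} (order : HasOrder G n) {X : Set x} {N : ℕ} (enum : Fin N ↔ X)
         (act : Group.Carrier G → X → X) where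
  open Group G
  open Inverse order using (to; from; strictlyInverseˡ; strictlyInverseʳ)
  private
    module E = Inverse enum

  module _ (act-cong : ∀ {a b} → a ≈ b → ∀ y → act a y ≡ act b y) (act-ε : ∀ y → act ε y ≡ y)
           (act-∙ : ∀ a b y → act (a ∙ b) y ≡ act a (act b y)) where
    private
      act-undo : ∀ a y → act (a ⁻¹) (act a y) ≡ y
      act-undo a y = ≡.trans (≡.sym (act-∙ _ _ _)) (≡.trans (act-cong (inverseˡ a) y) (act-ε y))

      act-from : ∀ a y → act (to (from a)) y ≡ act a y
      act-from a = act-cong (strictlyInverseˡ a)

      _~_ : Rel (Fin N) _
      y ~ z = ∃ λ k → act (to k) (E.to y) ≡ E.to z

    -- Distinct representatives lie in distinct orbits, and within an orbit a trivial stabiliser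
    -- makes the group element unique; hence `f` is a bijection, which also gives the count.
    free-orbits : (∀ a y → act a y ≡ y → a ≈ ε) →
      ∃₂ λ d (r : Fin d → X) → let f = λ ((o , k) : Fin d × Fin n) → act (to k) (r o) in
      (∀ {z z′} → f z ≡ f z′ → z ≡ z′) × (∀ y → ∃ λ z → f z ≡ y) × d * n ≡ N
    free-orbits free
      with d , r , onto , distinct ← representatives {_~_ = _~_}
             (from ε , ≡.trans (act-from ε _) (act-ε _))
             (λ (k , e) → from (to k ⁻¹) , ≡.trans (act-from _ _)
               (≡.trans (≡.cong (act (to k ⁻¹)) (≡.sym e)) (act-undo (to k) _)))
             (λ (k , e) (k′ , e′) → from (to k′ ∙ to k) , ≡.trans (act-from _ _)
               (≡.trans (act-∙ _ _ _) (≡.trans (≡.cong (act (to k′)) e) e′)))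
             -- The orbit relation is decided by searching the finite group, with equality in `X`
             -- tested through its enumeration.
             (λ y z → Fin.any? λ k →
               Fin.inj⇒≟ (Inverse⇒Injection (↔-sym enum)) (act (to k) (E.to y)) (E.to z))
      = d , E.to ∘ r , (λ {z} {z′} → inj z z′) , surj ,
        ↔⇒≡ (↔-sym enum ↔-∘ (⤖⇒↔ (mk⤖ ((λ {z} {z′} → inj z z′) ,
          λ y → let z , e = surj y in z , λ { ≡.refl → e })) ↔-∘ Fin.*↔×))
      where
      inj : ∀ z z′ → act (to (proj₂ z)) (E.to (r (proj₁ z))) ≡ act (to (proj₂ z′)) (E.to (r (proj₁ z′))) → z ≡ z′
      inj (o , k) (o′ , k′) e = helper (distinct o o′ (from (to k′ ⁻¹ ∙ to k) ,
          ≡.trans (act-from _ _) moved))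
        where
        moved : act (to k′ ⁻¹ ∙ to k) (E.to (r o)) ≡ E.to (r o′)
        moved = ≡.trans (act-∙ _ _ _) (≡.trans (≡.cong (act (to k′ ⁻¹)) e) (act-undo _ _))
        helper : o ≡ o′ → (o , k) ≡ (o′ , k′)
        helper ≡.refl = ≡.cong (o ,_) (≡.trans (≡.sym (strictlyInverseʳ k)) (≡.trans
          (Inverse.from-cong order (x∙y≈ε⇒ (free _ _ moved))) (strictlyInverseʳ k′)))
          where
          open GroupProperties G using (inverseʳ-unique; ⁻¹-involutive)
          x∙y≈ε⇒ : to k′ ⁻¹ ∙ to k ≈ ε → to k ≈ to k′
          x∙y≈ε⇒ h = trans (inverseʳ-unique _ _ h) (⁻¹-involutive _)

      surj : ∀ y → ∃ λ ((o , k) : Fin d × Fin n) → act (to k) (E.to (r o)) ≡ y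
      surj y with o , k , e ← onto (E.from y) = (o , k) , ≡.trans e (E.strictlyInverseˡ y)

module _ {K : CommutativeRing c ℓ} {G : Group g ℓg} {n : ℕ} (order : HasOrder G n)
         (T : Representation K G m ℓm) {X : Set x} {N : ℕ} (enum : Fin N ↔ X)
         (w : X → Module.Carrierᴹ (Representation.space T)) (B : DualBasis (Representation.space T) w)
         (move : Group.Carrier G → X → X) (s : Group.Carrier G → X → CommutativeRing.Carrier K) where
  private
    module K = CommutativeRing K
    module G = Group G
    module T = Representation T
    open Module T.space
    open Inverse order using (to)

  -- The signed basis consists of the translates of the chosen representatives themselves: freeness
  -- makes every index occur exactly once, so no index receives two conflicting signs.
  free-invariants-dimension :
    (∀ a y → s a y K.* s a y K.≈ K.1#) →
    (∀ a y → T.act a (w y) ≈ᴹ s a y *ₗ w (move a y)) →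
    (∀ {a b} → a G.≈ b → ∀ y → move a y ≡ move b y) → (∀ y → move G.ε y ≡ y) →
    (∀ a b y → move (a G.∙ b) y ≡ move a (move b y)) → (∀ a y → move a y ≡ y → a G.≈ G.ε) →
    ∃ λ d → HasDimension (Invariants T) d × d * n ≡ N
  free-invariants-dimension s²≈1 act-w move-cong move-ε move-∙ free
    with d , r , f-inj , f-surj , count ← free-orbits G order enum move move-cong move-ε move-∙ free
    = d , invariants-dimension order T (w ∘ r)
        (rebase T.space B _ (λ (o , k) → move (to k) (r o)) (λ (o , k) → s (to k) (r o))
          f-inj f-surj (λ (o , k) → s²≈1 (to k) (r o)) (λ (o , k) → act-w (to k) (r o)))
      , count

-- The action of the group on monomials in the regular representation

module _ (K : CommutativeRing c ℓ) (1≉0 : ¬ CommutativeRing._≈_ K (CommutativeRing.1# K) (CommutativeRing.0# K))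
         (A : AbelianGroup g ℓg) {n : ℕ} (order : HasOrder (AbelianGroup.group A) n) where
  private
    module K = CommutativeRing K
    module A = AbelianGroup A
    G : Group g ℓg
    G = A.group
    R : Representation K G (c ⊔ g) (c ⊔ ℓ ⊔ g ⊔ ℓg)
    R = regular K G
    module R = Representation R
    module V = Module R.space
    open Inverse order using (to; from; from-cong; strictlyInverseˡ; strictlyInverseʳ)

    e : Fin n → V.Carrierᴹ
    e l = gen (to l)

    tr : A.Carrier → Fin n → Fin n
    tr = translate G order

    tr-injective : ∀ a {l l′} → tr a l ≡ tr a l′ → l ≡ l′
    tr-injective a eq = ≡.trans (≡.sym (tr-cancel _)) (≡.trans (≡.cong (tr (a A.⁻¹)) eq) (tr-cancel _))
      where tr-cancel = translate-cancel G order (a A.⁻¹) a (A.inverseˡ a)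

    basis : ∀ k p → DualBasis (Power R.space k p) (monomial R.space k e)
    basis k p = powerDualBasis k (regularDualBasis K G order)

    actPower : A.Carrier → ∀ {p} → Comb K (Vector V.Carrierᴹ p) → Comb K (Vector V.Carrierᴹ p)
    actPower a = mapComb K (R.act a ∘_)

    actPower-cong : ∀ k a {p} {s t : Comb K (Vector V.Carrierᴹ p)} → Generated K (PowerRel R.space k p) s t →
                    Generated K (PowerRel R.space k p) (actPower a s) (actPower a t)
    actPower-cong sym a {p} = Representation.act-linear.⟦⟧-cong (𝒮 R p) a
    actPower-cong ext a {p} = Representation.act-linear.⟦⟧-cong (⋀ R p) a

    -- Acting by a⁻¹ would make a basis element zero.
    act-monomial-≉0 : ∀ k a {p} (M : Idx k n p) →
      ¬ Generated K (PowerRel R.space k p) (actPower a (monomial R.space k e M)) 𝟘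
    act-monomial-≉0 k a {p} M act≈0 = 1≉0 (K.trans (K.sym (coord-same M))
      (K.trans (coord-cong monomial≈0 M) (coord-0 M)))
      where
      open DualBasis (basis k p)
      monomial≈0 : Generated K (PowerRel R.space k p) (monomial R.space k e M) 𝟘
      monomial≈0 = ~-trans
        (gen-cong R.space k λ l → V.≈ᴹ-trans (V.≈ᴹ-sym (R.act-ε _))
          (V.≈ᴹ-trans (R.act-cong (A.sym (A.inverseˡ a)) _) (R.act-∙ (a A.⁻¹) a _)))
        (actPower-cong k (a A.⁻¹) act≈0)

    -- Acting by `a` relabels along `tr a`, so sorting applies; its zero outcome would let an
    -- invertible map kill a basis vector.
    act-monomial : ∀ k a {p} (M : Idx k n p) →
      SignedMonomial R.space k e (actPower a (monomial R.space k e M)) (push (tr a) (counts M))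
    act-monomial k a M with resp-signed R.space
      (gen-cong R.space k λ l → rel (same (A.sym (to-translate G order a (labels M l)))))
      (relabel R.space k e (tr a) M)
    ... | inj₁ act≈0  = contradiction act≈0 (act-monomial-≉0 k a M)
    ... | inj₂ moved = moved

    move : ∀ k → A.Carrier → ∀ {p} → Idx k n p → Idx k n p
    move k a M = SignedMonomial.idx (act-monomial k a M)

    lookup-move : ∀ k a {p} (M : Idx k n p) l → lookup (counts (move k a M)) (tr a l) ≡ lookup (counts M) l
    lookup-move k a M l = ≡.trans
      (≡.cong (λ b → lookup b (tr a l)) (SignedMonomial.count (act-monomial k a M)))
      (lookup-push (tr a) (tr-injective a) (counts M) l)

    -- Every label has the form `tr a l`, so the hypothesis fixes all multiplicities and with them
    -- the index. The action laws below use this and never inspect the sorting.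
    move-unique : ∀ k a {p} (M M′ : Idx k n p) →
      (∀ l → lookup (counts M′) (tr a l) ≡ lookup (counts M) l) → M′ ≡ move k a M
    move-unique k a M M′ h = counts-injective _ _ (lookup-injective λ l →
      ≡.subst (λ l → lookup (counts M′) l ≡ lookup (counts (move k a M)) l)
        (translate-cancel G order a (a A.⁻¹) (A.inverseʳ a) l)
        (≡.trans (h _) (≡.sym (lookup-move k a M _))))

    move-cong : ∀ k {a b} → a A.≈ b → ∀ {p} (M : Idx k n p) → move k a M ≡ move k b M
    move-cong k {a} {b} a≈b M = move-unique k b M _ λ l →
      ≡.trans (≡.cong (lookup (counts (move k a M))) (from-cong (A.∙-congʳ (A.sym a≈b))))
        (lookup-move k a M l)

    move-ε : ∀ k {p} (M : Idx k n p) → move k A.ε M ≡ M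
    move-ε k M = ≡.sym (move-unique k A.ε M M λ l →
      ≡.cong (lookup (counts M)) (≡.trans (from-cong (A.identityˡ (to l))) (strictlyInverseʳ l)))

    move-∙ : ∀ k a b {p} (M : Idx k n p) → move k (a A.∙ b) M ≡ move k a (move k b M)
    move-∙ k a b M = ≡.sym (move-unique k (a A.∙ b) M _ λ l →
      ≡.trans (≡.cong (lookup (counts (move k a (move k b M))))
          (from-cong (A.trans (A.assoc a b (to l)) (A.∙-congˡ (A.sym (to-translate G order b l))))))
        (≡.trans (lookup-move k a (move k b M) (tr b l)) (lookup-move k b M l)))

    fixed⇒invariant : ∀ k a {p} (M : Idx k n p) → move k a M ≡ M →
                      ∀ l → lookup (counts M) (tr a l) ≡ lookup (counts M) l
    fixed⇒invariant k a M eq l =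
      ≡.trans (≡.cong (λ M → lookup (counts M) (tr a l)) (≡.sym eq)) (lookup-move k a M l)

  module _ (p q m : ℕ) where
    private
      T : Representation K G _ _
      T = 𝒮 R p ⊗ ⋀ R m
      module T = Representation T
      module TS = Module T.space

      Pair : Set
      Pair = Idx sym n p × Idx ext n m

      movePair : A.Carrier → Pair → Pair
      movePair a (M , S) = move sym a M , move ext a S

      enumeratePairs : Fin (size sym n p * size ext n m) ↔ Pair
      enumeratePairs = (enumerate sym n p ×-↔ enumerate ext n m) ↔-∘ Fin.*↔×

      pairMonomial : Pair → TS.Carrierᴹ
      pairMonomial (M , S) = gen (monomial R.space sym e M , monomial R.space ext e S)

      pairSign : A.Carrier → Pair → K.Carrier
      pairSign a (M , S) = SignedMonomial.s (act-monomial sym a M) K.* SignedMonomial.s (act-monomial ext a S)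

      pairSign² : ∀ a MS → pairSign a MS K.* pairSign a MS K.≈ K.1#
      pairSign² a (M , S) = K.trans (interchange _ _ _ _)
        (K.trans (K.*-cong (SignedMonomial.s²≈1 (act-monomial sym a M))
                           (SignedMonomial.s²≈1 (act-monomial ext a S))) (K.*-identityˡ _))
        where open CommutativeSemigroupProperties K.*-commutativeSemigroup using (interchange)

      act-pairMonomial : ∀ a MS → T.act a (pairMonomial MS) TS.≈ᴹ pairSign a MS TS.*ₗ pairMonomial (movePair a MS)
      act-pairMonomial a (M , S) = ~-trans
        (rel (cong (SignedMonomial.≈s⊙ (act-monomial sym a M)) (SignedMonomial.≈s⊙ (act-monomial ext a S))))
        (~-trans (rel (scaleˡ _ _ _)) (~-trans (⊙-cong K.refl (rel (scaleʳ _ _ _))) (~-sym (⊙-assoc _ _ _))))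

      pairBasis : DualBasis T.space pairMonomial
      pairBasis = tensorDualBasis (Power R.space sym p) (Power R.space ext m)
        (Fin.inj⇒≟ (Inverse⇒Injection (↔-sym (enumerate sym n p)))) (basis sym p) (basis ext m)

    invariants-dimension-count : q + m ≡ n → gcd (gcd p q) m ≡ 1 →
      ∃ λ d → HasDimension (Invariants (𝒮 R p ⊗ ⋀ R m)) d × d * n ≡ size sym n p * size ext n m
    invariants-dimension-count q+m≡n coprime
      = free-invariants-dimension order T enumeratePairs pairMonomial pairBasis movePair pairSign
          pairSign² act-pairMonomial
          (λ a≈b (M , S) → ≡.cong₂ _,_ (move-cong sym a≈b M) (move-cong ext a≈b S))
          (λ (M , S) → ≡.cong₂ _,_ (move-ε sym M) (move-ε ext S))
          (λ a b (M , S) → ≡.cong₂ _,_ (move-∙ sym a b M) (move-∙ ext a b S))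
          (λ a (M , S) fixed → invariant⇒trivial A order p q m q+m≡n coprime a M S
            (fixed⇒invariant sym a M (×.,-injectiveˡ fixed)) (fixed⇒invariant ext a S (×.,-injectiveʳ fixed)))

-- Complex coefficients and comparison of the two dimensions

-- The difference of the real parts is the constant sequence 1, which never falls below one half.
1≉0-ℂ : ¬ (1ℂ ≈ℂ 0ℂ)
1≉0-ℂ 1≈0 with N , small ← _≈ℝ_.null (_≈ℂ_.re-≈ 1≈0) ℚ.½ (ℚ.positive⁻¹ ℚ.½) =
  from-no (ℚ.1ℚ ℚ.<? ℚ.½) (small N ℕ.≤-refl)

multinomial-comm : ∀ p q m → multinomial q p m ≡ multinomial p q m
multinomial-comm p q m = ≡.trans
  (/-congˡ {o = q ! * p ! * m !} {{factorials≢0 q p m}} (≡.cong (λ N → (N + m) !) (ℕ.+-comm q p)))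
  (/-congʳ {m = (p + q + m) !} {{factorials≢0 q p m}} {{factorials≢0 p q m}}
    (≡.cong (_* m !) (ℕ.*-comm (q !) (p !))))

inhabited⇒suc : ∀ {N} → Fin N → ∃ λ n → N ≡ suc n
inhabited⇒suc zero    = _ , ≡.refl
inhabited⇒suc (suc _) = _ , ≡.refl

dimension-multinomial : (K : CommutativeRing c ℓ) →
  ¬ CommutativeRing._≈_ K (CommutativeRing.1# K) (CommutativeRing.0# K) →
  (A : AbelianGroup g ℓg) (p q m : ℕ) → HasOrder (AbelianGroup.group A) (q + m) →
  gcd (gcd p q) m ≡ 1 →
  let R = regular K (AbelianGroup.group A) in
  ∃ λ d → HasDimension (Invariants (𝒮 R p ⊗ ⋀ R m)) d × d * (p + q + m) ≡ multinomial p q m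
dimension-multinomial K 1≉0 A p q m order coprime =
  Product.map₂ (λ {d} → Product.map₂ (count d)) (invariants-dimension-count K 1≉0 A order p q m ≡.refl coprime)
  where
  count : ∀ d → d * (q + m) ≡ size sym (q + m) p * size ext (q + m) m → d * (p + q + m) ≡ multinomial p q m
  -- The identity element witnesses that the order `q + m` is positive.
  count d d*n≡ = let n , q+m≡ = inhabited⇒suc (Inverse.from order (AbelianGroup.ε A)) in
    orbits-count p q m n d q+m≡ (≡.subst (λ N → d * N ≡ size sym N p * size ext N m) q+m≡ d*n≡)

theorem1p3 : ∀ {g ℓg h ℓh : Level} (p q m : ℕ)
    (G : AbelianGroup g ℓg) (H : AbelianGroup h ℓh) →
    HasOrder (AbelianGroup.group G) (q + m) →
    HasOrder (AbelianGroup.group H) (p + m) →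
    gcd (gcd p q) m ≡ 1 →
    let R = regular ℂ-commutativeRing (AbelianGroup.group G)
        R̃ = regular ℂ-commutativeRing (AbelianGroup.group H)
    in ∃ λ (d : ℕ) →
         HasDimension (Invariants (𝒮 R p ⊗ ⋀ R m)) d ×
         HasDimension (Invariants (𝒮 R̃ q ⊗ ⋀ R̃ m)) d ×
         d * (p + q + m) ≡ multinomial p q m
theorem1p3 p q m G H orderG orderH coprime = common
  (dimension-multinomial ℂ-commutativeRing 1≉0-ℂ G p q m orderG coprime)
  (dimension-multinomial ℂ-commutativeRing 1≉0-ℂ H q p m orderH
    (≡.trans (≡.cong (λ k → gcd k m) (gcd-comm q p)) coprime))
  where
  instance
    -- If the sum were 0, all three numbers would be 0 and so would their gcd.
    nonZero : NonZero (p + q + m)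
    nonZero = ℕ.≢-nonZero λ eq → contradiction
      (≡.trans (≡.sym coprime) (≡.cong₂ gcd (≡.cong₂ gcd (ℕ.m+n≡0⇒m≡0 p (ℕ.m+n≡0⇒m≡0 (p + q) eq))
        (ℕ.m+n≡0⇒n≡0 p (ℕ.m+n≡0⇒m≡0 (p + q) eq))) (ℕ.m+n≡0⇒n≡0 (p + q) eq))) λ ()

  common : ∀ {x y} {P : ℕ → Set x} {Q : ℕ → Set y} →
    (∃ λ d → P d × d * (p + q + m) ≡ multinomial p q m) →
    (∃ λ d → Q d × d * (q + p + m) ≡ multinomial q p m) →
    ∃ λ d → P d × Q d × d * (p + q + m) ≡ multinomial p q m
  common {Q = Q} (d , Pd , d≡) (d′ , Qd′ , d′≡) = d , Pd , ≡.subst Q d′≡d Qd′ , d≡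
    where
    -- Both dimensions solve the same equation, by symmetry of the multinomial in `p` and `q`, and
    -- the nonzero factor cancels.
    d′≡d : d′ ≡ d
    d′≡d = ℕ.*-cancelʳ-≡ d′ d (p + q + m) (≡.trans (≡.cong (λ N → d′ * (N + m)) (ℕ.+-comm p q))
      (≡.trans d′≡ (≡.trans (multinomial-comm p q m) (≡.sym d≡))))
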